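{- Let $\mathbf{a}$ be a weak composition of length $n$. There is an injective map $\Phi:\mathrm{LKT}(\mathbf{a})\to\mathrm{KKT}(\mathbf{a})$ such that $\mathrm{wt}(\Phi(T))=\mathrm{wt}(T)$ for all $T$, and for every $T\in\mathrm{LKT}(\mathbf{a})$ and $1\le i<n$: if $e_i(T)\neq0$ then $\Phi(e_i(T))=e_i(\Phi(T))$, and if $f_i(T)\neq0$ then $\Phi(f_i(T))=f_i(\Phi(T))$. (Here $e_i,f_i$ on the left are the lock raising/lowering operators and on the right the key raising/lowering operators.)
   Context: A weak composition is a finite sequence $\mathbf{a}=(a_1,\ldots,a_n)$ of nonnegative integers. A diagram is a finite set of cells $(c,r)$ with $c,r$ positive integers ($c$ column, $r$ row, rows numbered from the bottom). A labeled diagram assigns a positive integer label to each cell; $\mathbb{D}(T)$ is its underlying diagram, and its weight $\mathrm{wt}(T)$ is the weak composition whose $r$-th part is the number of cells in row $r$. A key Kohnert tableau of content $\mathbf{a}$: labels $1^{a_1},\ldots,n^{a_n}$, one per cell, with (K1) exactly one $i$ in each of columns $1,\ldots,a_i$; (K2) every label in row $r$ is at least $r$; (K3) cells labeled $i$ weakly descend from left to right; (K4) if $i<j$ appear in a column with $i$ above $j$, there is an $i$ in the column immediately to the right strictly above the row of that $j$. A lock Kohnert tableau of content $\mathbf{a}$ (with $M=\max_i a_i$): labels $1^{a_1},\ldots,n^{a_n}$, one per cell, with (L1) exactly one $i$ in each of columns $M-a_i+1,\ldots,M$; (L2)=(K2); (L3)=(K3); (L4) labels strictly decrease going down each column. $\mathrm{KKT}(\mathbf{a})$,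 $\mathrm{LKT}(\mathbf{a})$ denote these sets; in each set, a diagram has at most one valid labeling. Raising operators on diagrams: the vertical $i$-pairing of $D$ pairs cells of rows $i,i+1$ in the same column, then iteratively pairs any unpaired cell of row $i+1$ with the rightmost unpaired cell of row $i$ in a column to its left whenever all cells of rows $i,i+1$ in the columns strictly between them are paired; $e_i(D)$ moves the rightmost unpaired cell of row $i+1$ to row $i$ (same column), and $e_i(D)=0$ if there is none. Key raising operator: for $T\in\mathrm{KKT}(\mathbf{a})$, $e_i(T)$ is the unique element of $\mathrm{KKT}(\mathbf{a})$ with underlying diagram $e_i(\mathbb{D}(T))$ if $e_i(\mathbb{D}(T))\ne0$ (such an element always exists), else $0$. Lock raising operator: for $T\in\mathrm{LKT}(\mathbf{a})$, $e_i(T)$ is the unique element of $\mathrm{LKT}(\mathbf{a})$ with underlying diagram $e_i(\mathbb{D}(T))$ if $e_i(\mathbb{D}(T))\neq0$ and such an element exists, else $0$. In either set $X$, the lowering operator is $f_i(T)=T'$ if $T'\in X$ satisfies $e_i(T')=T$, and $f_i(T)=0$ if no such $T'$ exists. -}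

module Defs where

open import Data.Nat using (ℕ; zero; suc; _+_; _∸_; _≤_; _<_; _⊔_)
open import Data.Bool using (Bool; true; false; if_then_else_)
open import Data.Maybe using (Maybe; just; nothing; is-just)
open import Data.Fin using (Fin; toℕ)
open import Data.Vec using (Vec; []; _∷_; lookup; tabulate; map; foldr)
open import Data.Product using (Σ; ∃; _×_; _,_; proj₁)
open import Relation.Binary.PropositionalEquality using (_≡_)

-- Conventions.
-- A weak composition of length n is  a : Vec ℕ n  (a_i = lookup a (i-1)).
-- M a = max_i a_i.
-- A labeled diagram (for content a) is a grid  LD M n : column c (Fin M,
-- 1-based column toℕ c + 1) ↦ row r (Fin n, 1-based row toℕ r + 1) ↦
-- Maybe label; "just ℓ" means the cell (c,r) is in the diagram with label ℓ.
-- Every element of KKT(a) and LKT(a) lives in columns 1..M and rows 1..n, so this grid loses nothing.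
-- A diagram is the same grid with Bool entries (true = cell present).

maxV : ∀ {n} → Vec ℕ n → ℕ
maxV = foldr _ _⊔_ 0

LD : ℕ → ℕ → Set
LD M n = Vec (Vec (Maybe ℕ) n) M

Diagram : ℕ → ℕ → Set
Diagram M n = Vec (Vec Bool n) M

L : ∀ {M n} → LD M n → Fin M → Fin n → Maybe ℕ
L T c r = lookup (lookup T c) r

𝔻 : ∀ {M n} → LD M n → Diagram M n
𝔻 = map (map is-just)

b2n : Bool → ℕ
b2n true = 1
b2n false = 0

rowCount : ∀ {M n} → Fin n → Diagram M n → ℕ
rowCount r = foldr _ (λ col k → b2n (lookup col r) + k) 0

wt : ∀ {M n} → Diagram M n → Vec ℕ n
wt D = tabulate (λ r → rowCount r D)

isLabel : ℕ → Maybe ℕ → Bool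
isLabel ℓ (just m) = Data.Nat._≡ᵇ_ ℓ m
isLabel ℓ nothing = false

countColumn : ∀ {n} → ℕ → Vec (Maybe ℕ) n → ℕ
countColumn ℓ = foldr _ (λ x k → b2n (isLabel ℓ x) + k) 0

countAll : ∀ {M n} → ℕ → LD M n → ℕ
countAll ℓ = foldr _ (λ col k → countColumn ℓ col + k) 0

Content : ∀ {M n} → Vec ℕ n → LD M n → Set
Content {M} {n} a T =
  (∀ c r ℓ → L T c r ≡ just ℓ → 1 ≤ ℓ × ℓ ≤ n) ×
  (∀ (k : Fin n) → countAll (suc (toℕ k)) T ≡ lookup a k)

RowCond : ∀ {M n} → LD M n → Set
RowCond T = ∀ c r ℓ → L T c r ≡ just ℓ → suc (toℕ r) ≤ ℓ

DescCond : ∀ {M n} → LD M n → Set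
DescCond T = ∀ c c' r r' ℓ → L T c r ≡ just ℓ → L T c' r' ≡ just ℓ →
  toℕ c < toℕ c' → toℕ r' ≤ toℕ r

K1 : ∀ {n} (a : Vec ℕ n) → LD (maxV a) n → Set
K1 {n} a T = ∀ (k : Fin n) (c : Fin (maxV a)) → toℕ c < lookup a k →
  countColumn (suc (toℕ k)) (lookup T c) ≡ 1

K4 : ∀ {M n} → LD M n → Set
K4 {M} {n} T = ∀ c r s i j → L T c r ≡ just i → L T c s ≡ just j → i < j →
  toℕ s < toℕ r →
  Σ (Fin M) λ c' → Σ (Fin n) λ t →
    toℕ c' ≡ suc (toℕ c) × toℕ s < toℕ t × L T c' t ≡ just i

L1 : ∀ {n} (a : Vec ℕ n) → LD (maxV a) n → Set
L1 {n} a T = ∀ (k : Fin n) (c : Fin (maxV a)) → maxV a ∸ lookup a k ≤ toℕ c →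
  countColumn (suc (toℕ k)) (lookup T c) ≡ 1

L4 : ∀ {M n} → LD M n → Set
L4 T = ∀ c r s ℓ m → L T c r ≡ just ℓ → L T c s ≡ just m →
  toℕ s < toℕ r → m < ℓ

IsKKT : ∀ {n} (a : Vec ℕ n) → LD (maxV a) n → Set
IsKKT a T = Content a T × K1 a T × RowCond T × DescCond T × K4 T

IsLKT : ∀ {n} (a : Vec ℕ n) → LD (maxV a) n → Set
IsLKT a T = Content a T × L1 a T × RowCond T × DescCond T × L4 T

KKT : ∀ {n} → Vec ℕ n → Set
KKT {n} a = Σ (LD (maxV a) n) (IsKKT a)

LKT : ∀ {n} → Vec ℕ n → Set
LKT {n} a = Σ (LD (maxV a) n) (IsLKT a)

-- Raising operator e_i on diagrams (i is the 1-based row index).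
-- Vertical i-pairing, read left to right over the columns: a column with
-- cells in both rows i,i+1 is paired within itself; a column with only a
-- row-i cell is an "open" cell; a column with only a row-(i+1) cell pairs
-- with the rightmost unpaired open cell to its left (all cells strictly
-- between being paired), i.e. ordinary bracket matching.  We record the
-- column of the rightmost unpaired row-(i+1) cell.

cellAt : ∀ {n} → Vec Bool n → ℕ → Bool
cellAt [] _ = false
cellAt (x ∷ xs) zero = x
cellAt (x ∷ xs) (suc k) = cellAt xs k

setAt : ∀ {n} → Vec Bool n → ℕ → Bool → Vec Bool n
setAt [] _ _ = []
setAt (x ∷ xs) zero b = b ∷ xs
setAt (x ∷ xs) (suc k) b = x ∷ setAt xs k b

-- scan columns; k = current column index (0-based), o = number of
-- currently unpaired row-i cells, m = last unpaired row-(i+1) column so far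
scanPair : ∀ {M n} → ℕ → ℕ → ℕ → Maybe ℕ → Vec (Vec Bool n) M → Maybe ℕ
scanPair i k o m [] = m
scanPair i k o m (col ∷ cs) with cellAt col (i ∸ 1) | cellAt col i
... | true  | false = scanPair i (suc k) (suc o) m cs
... | false | true  with o
...    | zero  = scanPair i (suc k) zero (just k) cs
...    | suc o' = scanPair i (suc k) o' m cs
scanPair i k o m (col ∷ cs) | _ | _ = scanPair i (suc k) o m cs

moveDown : ∀ {n} → ℕ → Vec Bool n → Vec Bool n
moveDown i col = setAt (setAt col i false) (i ∸ 1) true

updateCol : ∀ {M n} → ℕ → (Vec Bool n → Vec Bool n) → Diagram M n → Diagram M n
updateCol _ g [] = []
updateCol zero g (col ∷ cs) = g col ∷ cs
updateCol (suc k) g (col ∷ cs) = col ∷ updateCol k g cs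

-- e_i(D); nothing represents 0
eD : ∀ {M n} → ℕ → Diagram M n → Maybe (Diagram M n)
eD i D with scanPair i 0 0 nothing D
... | nothing = nothing
... | just k = just (updateCol k (moveDown i) D)

-- Raising / lowering operators on tableaux, as relations:
-- "KeyE a i T T'"  means  e_i(T) = T'  (key raising operator), i.e.
-- T' ∈ KKT(a) with 𝔻(T') = e_i(𝔻(T)); e_i(T) ≠ 0 iff such T' exists.
-- "KeyF a i T T'"  means  f_i(T) = T', i.e. T' ∈ KKT(a) and e_i(T') = T.

KeyE : ∀ {n} (a : Vec ℕ n) → ℕ → LD (maxV a) n → LD (maxV a) n → Set
KeyE a i T T' = IsKKT a T' × eD i (𝔻 T) ≡ just (𝔻 T')

KeyF : ∀ {n} (a : Vec ℕ n) → ℕ → LD (maxV a) n → LD (maxV a) n → Set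
KeyF a i T T' = IsKKT a T' × KeyE a i T' T

LockE : ∀ {n} (a : Vec ℕ n) → ℕ → LD (maxV a) n → LD (maxV a) n → Set
LockE a i T T' = IsLKT a T' × eD i (𝔻 T) ≡ just (𝔻 T')

LockF : ∀ {n} (a : Vec ℕ n) → ℕ → LD (maxV a) n → LD (maxV a) n → Set
LockF a i T T' = IsLKT a T' × LockE a i T' T

{-# OPTIONS --safe #-}
module Submission where

-- View a diagram as its list of columns.  Two neighbouring columns C, X are swapped by matching, from
-- the top row down, each cell of C with a cell of X weakly below it and moving the unmatched cells of X
-- to C.  This preserves row sums, commutes with all vertical raising operators (the two commuting
-- crystal structures on 0/1-matrices), and is invertible if all cells of C get matched.  Φ sorts the
-- columns of a lock diagram, whose sizes increase, into decreasing order by such swaps.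
--
-- The swaps satisfy exchange laws, so they preserve the column obtained by bringing the j-th column to
-- the far left.  By conditions (L2), (L3) this column is componentwise at most the label set of the j-th
-- column.  For the sorted diagram these bounds for all j say exactly that the greedy key labelling
-- (columns from right to left, cells from bottom to top, least available label) satisfies (K2).

open import Defs
open import Data.Bool as Bool using (Bool; true; false; not; if_then_else_)
open import Data.Bool.Properties using (T-≡; not-involutive)
open import Data.Empty using (⊥-elim)
open import Data.Fin using (Fin; zero; suc; toℕ; fromℕ<)
open import Data.Fin.Properties using (toℕ-fromℕ<; toℕ<n; toℕ-injective)
open import Data.Maybe as Maybe using (Maybe; just; nothing; maybe′; is-just)
open import Data.Maybe.Properties using (just-injective)
import Data.Maybe.Properties as Maybeₚ
open import Data.Nat
open import Data.Nat.Properties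
open import Algebra.Properties.CommutativeSemigroup +-commutativeSemigroup using (x∙yz≈y∙xz; interchange)
open import Data.Product using (Σ; ∃; _×_; _,_; proj₁; proj₂)
open import Data.Sum using (_⊎_; inj₁; inj₂)
open import Data.Unit using (⊤; tt)
open import Data.Vec as Vec using (Vec; []; _∷_; lookup; _∷ʳ_; init; last; replicate; tabulate)
open import Data.Vec.Properties
  using (∷ʳ-injective; init-∷ʳ; last-∷ʳ; lookup-map; lookup∘tabulate; lookup-replicate;
    map-cong; map-∘; tabulate-cong; tabulate∘lookup)
open import Function using (_∘_; id)
open import Function.Bundles using (Equivalence)
open import Relation.Binary.PropositionalEquality
open import Relation.Nullary using (yes; no)

-- The labels are not carried through the swaps: the map forgets them, moves the bare diagram and
-- labels the result afresh. The original tableau can be recovered from its diagram because (L4)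
-- fixes the order of the labels in each column. Reversing the order of the sizes is the right move
-- since, counting columns from 0, column `c` of a lock tableau contains the labels i with a_i > M -
-- 1 - c and column `c` of a key tableau those with a_i > c: the same label sets occur in opposite
-- order. A swap moves every unmatched cell, so it is the highest power of a horizontal raising
-- operator, and the exchange laws and the commutation with `eD` hold for arbitrary columns.
-- Inversion is the delicate point. The bounds that serve (K2) settle it too: an unmatched cell of
-- the left column would make a column brought to the far left larger than its label set. Both
-- matchings are estimated by cuts between rows, so the bounds pass from column to column as
-- inequalities between cell counts, and no individual cell has to be followed.

private variable
  n m : ℕ

-- Swapping two columns

-- One row of the swap of C and X, read from the top down.  The counter is the number of cells of C
-- still waiting for a cell of X weakly below them; a cell of X for which no cell waits moves to C.
emit : Bool → Bool → ℕ → ℕ × Bool × Bool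
emit false false k = k , false , false
emit true true k = k , true , true
emit true false k = suc k , true , false
emit false true zero = zero , true , false
emit false true (suc k) = k , false , true

-- The inverse of emit, read from the bottom up.
absorb : Bool → Bool → ℕ → ℕ × Bool × Bool
absorb false false k = k , false , false
absorb true true k = k , true , true
absorb false true k = suc k , false , true
absorb true false zero = zero , false , true
absorb true false (suc k) = k , true , false

next : ℕ × Bool × Bool → ℕ
next = proj₁

fst snd : ℕ × Bool × Bool → Bool
fst = proj₁ ∘ proj₂
snd = proj₂ ∘ proj₂

surplus : Vec Bool n → Vec Bool n → ℕ
surplus [] [] = 0
surplus (c ∷ C) (x ∷ X) = next (emit c x (surplus C X))

swapˡ swapʳ : Vec Bool n → Vec Bool n → Vec Bool n
swapˡ [] [] = []
swapˡ (c ∷ C) (x ∷ X) = fst (emit c x (surplus C X)) ∷ swapˡ C X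
swapʳ [] [] = []
swapʳ (c ∷ C) (x ∷ X) = snd (emit c x (surplus C X)) ∷ swapʳ C X

backˡ backʳ : ℕ → Vec Bool n → Vec Bool n → Vec Bool n
backˡ k [] [] = []
backˡ k (u ∷ U) (v ∷ V) = fst (absorb u v k) ∷ backˡ (next (absorb u v k)) U V
backʳ k [] [] = []
backʳ k (u ∷ U) (v ∷ V) = snd (absorb u v k) ∷ backʳ (next (absorb u v k)) U V

absorb-emit : ∀ c x k → let (k' , t , s) = emit c x k in absorb t s k' ≡ (k , c , x)
absorb-emit false false k = refl
absorb-emit true true k = refl
absorb-emit true false k = refl
absorb-emit false true zero = refl
absorb-emit false true (suc k) = refl

backˡ-inverse : (C X : Vec Bool n) → backˡ (surplus C X) (swapˡ C X) (swapʳ C X) ≡ C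
backˡ-inverse [] [] = refl
backˡ-inverse (c ∷ C) (x ∷ X) rewrite absorb-emit c x (surplus C X) = cong (c ∷_) (backˡ-inverse C X)

backʳ-inverse : (C X : Vec Bool n) → backʳ (surplus C X) (swapˡ C X) (swapʳ C X) ≡ X
backʳ-inverse [] [] = refl
backʳ-inverse (c ∷ C) (x ∷ X) rewrite absorb-emit c x (surplus C X) = cong (x ∷_) (backʳ-inverse C X)

-- Coupled p q k l m means q = k ⊓ m and p = l + (m ∸ k).
data Coupled : ℕ → ℕ → ℕ → ℕ → ℕ → Set where
  low  : ∀ {q s u} d → s ≡ q + d → Coupled u q s u q
  high : ∀ {p q u v} w → p ≡ w + u → v ≡ q + w → Coupled p q q u v

-- An exchange law compares two ways of moving `V` past `A` and `B`, with two matchings on one side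
-- (counters `p`, `q`) and three on the other (`k`, `l`, `m`). Run in parallel, row by row, the
-- counters may differ; this relation among them is an invariant strong enough to force equal bits
-- in the leftmost column.
absorb-coupled : ∀ t s v {p q k l m} → Coupled p q k l m →
  let inner = absorb s v p ; outer = absorb t (fst inner) q
      swap = absorb t s k ; inner' = absorb (snd swap) v l
      outer' = absorb (fst swap) (fst inner') m in
  fst outer ≡ fst outer' ×
  Coupled (next inner) (next outer) (next swap) (next inner') (next outer')
absorb-coupled false false false r = refl , r
absorb-coupled true true true r = refl , r
absorb-coupled false false true (low d e) = refl , low d e
absorb-coupled false false true {l = l} (high w refl e) = refl , high w (sym (+-suc w l)) e
absorb-coupled false true true (low d e) = refl , low d (cong suc e)
absorb-coupled false true true (high w e e') = refl , high w e (cong suc e')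
absorb-coupled true true false {q = zero} {l = zero} (low d e) = refl , low d e
absorb-coupled true true false {q = suc q} {l = zero} (low d e) =
  refl , low (suc d) (trans e (sym (+-suc q d)))
absorb-coupled true true false {l = suc l} (low d e) = refl , low d e
absorb-coupled true true false {q = q} {l = suc l} (high w refl e) rewrite +-suc w l = refl , high w refl e
absorb-coupled true true false {q = zero} {l = zero} (high zero refl refl) = refl , high zero refl refl
absorb-coupled true true false {q = suc q} {l = zero} (high zero refl refl) rewrite +-identityʳ q =
  refl , low 1 (+-comm 1 q)
absorb-coupled true true false {q = q} {l = zero} (high (suc w) refl refl) rewrite +-suc q w = refl , high w refl refl
absorb-coupled true false true {q = zero} (low zero refl) = refl , high 1 refl refl
absorb-coupled true false true {q = zero} (low (suc d) refl) = refl , low d refl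
absorb-coupled true false true {q = suc q} (low d refl) = refl , low d refl
absorb-coupled true false true {q = zero} (high w refl refl) = refl , high (suc w) refl refl
absorb-coupled true false true {q = suc q} {l = l} (high w refl refl) = refl , high w (sym (+-suc w l)) refl
absorb-coupled false true false {q = q} {l = zero} (low d refl) = refl , low (suc d) (sym (+-suc q d))
absorb-coupled false true false {l = suc l} (low d refl) = refl , low d refl
absorb-coupled false true false {l = suc l} (high w refl refl) rewrite +-suc w l = refl , high w refl refl
absorb-coupled false true false {q = q} {l = zero} (high zero refl refl) rewrite +-identityʳ q =
  refl , low 1 (+-comm 1 q)
absorb-coupled false true false {q = q} {l = zero} (high (suc w) refl refl) = refl , high w refl (+-suc q w)
absorb-coupled true false false {q = zero} {l = zero} (low zero refl) = refl , low zero refl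
absorb-coupled true false false {q = zero} {l = suc l} (low zero refl) = refl , high 1 refl refl
absorb-coupled true false false {q = zero} (low (suc d) refl) = refl , low d refl
absorb-coupled true false false {q = suc q} (low d refl) = refl , low d refl
absorb-coupled true false false {q = zero} {l = zero} (high w refl refl) = refl , high w refl refl
absorb-coupled true false false {q = zero} {l = suc l} (high w refl refl) = refl , high (suc w) (+-suc w l) refl
absorb-coupled true false false {q = suc q} (high w refl refl) = refl , high w refl refl

backˡ-coupled : ∀ (A B V : Vec Bool n) {p q k l m} → Coupled p q k l m →
  backˡ q A (backˡ p B V) ≡ backˡ m (backˡ k A B) (backˡ l (backʳ k A B) V)
backˡ-coupled [] [] [] r = refl
backˡ-coupled (t ∷ A) (s ∷ B) (v ∷ V) r with absorb-coupled t s v r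
... | e , r' = cong₂ _∷_ e (backˡ-coupled A B V r')

-- The leftmost component of a Yang-Baxter relation: the column that `V` becomes at the far left
-- does not depend on whether the two columns it passes were exchanged beforehand.
backˡ-braid : ∀ (A B V : Vec Bool n) → backˡ 0 A (backˡ 0 B V) ≡ backˡ 0 (backˡ 0 A B) (backˡ 0 (backʳ 0 A B) V)
backˡ-braid A B V = backˡ-coupled A B V (low 0 refl)

emit-absorb-not : ∀ c x k → let (k' , u , v) = absorb (not c) (not x) k in emit c x k ≡ (k' , not u , not v)
emit-absorb-not false false k = refl
emit-absorb-not true true k = refl
emit-absorb-not true false k = refl
emit-absorb-not false true zero = refl
emit-absorb-not false true (suc k) = refl

-- Complementing all the bits turns emit into absorb, so swapˡ obeys the same exchange law as backˡ.
swapˡ-coupled : ∀ (C X V : Vec Bool n) →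
  Coupled (surplus X V) (surplus C (swapˡ X V)) (surplus C X) (surplus (swapʳ C X) V)
    (surplus (swapˡ C X) (swapˡ (swapʳ C X) V)) ×
  swapˡ C (swapˡ X V) ≡ swapˡ (swapˡ C X) (swapˡ (swapʳ C X) V)
swapˡ-coupled [] [] [] = low 0 refl , refl
swapˡ-coupled (c ∷ C) (x ∷ X) (v ∷ V) with swapˡ-coupled C X V
... | r , e with absorb-coupled (not c) (not x) (not v) r
... | f , r'
  rewrite emit-absorb-not x v (surplus X V)
        | emit-absorb-not c (not (fst (absorb (not x) (not v) (surplus X V)))) (surplus C (swapˡ X V))
        | emit-absorb-not c x (surplus C X)
        | emit-absorb-not (not (snd (absorb (not c) (not x) (surplus C X)))) v (surplus (swapʳ C X) V)
        | not-involutive (fst (absorb (not x) (not v) (surplus X V)))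
        | not-involutive (snd (absorb (not c) (not x) (surplus C X)))
        | emit-absorb-not (not (fst (absorb (not c) (not x) (surplus C X))))
            (not (fst (absorb (snd (absorb (not c) (not x) (surplus C X))) (not v) (surplus (swapʳ C X) V))))
            (surplus (swapˡ C X) (swapˡ (swapʳ C X) V))
        | not-involutive (fst (absorb (not c) (not x) (surplus C X)))
        | not-involutive (fst (absorb (snd (absorb (not c) (not x) (surplus C X))) (not v) (surplus (swapʳ C X) V)))
  = r' , cong₂ _∷_ (cong not f) e

swapˡ-braid : ∀ (C X V : Vec Bool n) → swapˡ C (swapˡ X V) ≡ swapˡ (swapˡ C X) (swapˡ (swapʳ C X) V)
swapˡ-braid C X V = proj₂ (swapˡ-coupled C X V)

-- Finite sums

total : (Fin n → ℕ) → ℕ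
total {zero} f = 0
total {suc n} f = f zero + total (f ∘ suc)

below above : ℕ → (Fin n → ℕ) → ℕ
below {n} zero f = 0
below {zero} (suc x) f = 0
below {suc n} (suc x) f = f zero + below x (f ∘ suc)
above {n} zero f = total f
above {zero} (suc x) f = 0
above {suc n} (suc x) f = above x (f ∘ suc)

below+above : ∀ x (f : Fin n → ℕ) → below x f + above x f ≡ total f
below+above zero f = refl
below+above {zero} (suc x) f = refl
below+above {suc n} (suc x) f = trans (+-assoc (f zero) _ _) (cong (f zero +_) (below+above x (f ∘ suc)))

total-cong : {f g : Fin n → ℕ} → (∀ i → f i ≡ g i) → total f ≡ total g
total-cong {zero} e = refl
total-cong {suc n} e = cong₂ _+_ (e zero) (total-cong (e ∘ suc))

total-mono : {f g : Fin n → ℕ} → (∀ i → f i ≤ g i) → total f ≤ total g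
total-mono {zero} b = z≤n
total-mono {suc n} b = +-mono-≤ (b zero) (total-mono (b ∘ suc))

above-cong : ∀ x {f g : Fin n → ℕ} → (∀ i → f i ≡ g i) → above x f ≡ above x g
above-cong zero e = total-cong e
above-cong {zero} (suc x) e = refl
above-cong {suc n} (suc x) e = above-cong x (e ∘ suc)

above-mono : ∀ x {f g : Fin n → ℕ} → (∀ i → f i ≤ g i) → above x f ≤ above x g
above-mono zero b = total-mono b
above-mono {zero} (suc x) b = z≤n
above-mono {suc n} (suc x) b = above-mono x (b ∘ suc)

total-+ : (f g : Fin n → ℕ) → total (λ i → f i + g i) ≡ total f + total g
total-+ {zero} f g = refl
total-+ {suc n} f g = trans (cong (f zero + g zero +_) (total-+ (f ∘ suc) (g ∘ suc)))
  (interchange (f zero) (g zero) _ _)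

above-+ : ∀ x (f g : Fin n → ℕ) → above x (λ i → f i + g i) ≡ above x f + above x g
above-+ zero f g = total-+ f g
above-+ {zero} (suc x) f g = refl
above-+ {suc n} (suc x) f g = above-+ x (f ∘ suc) (g ∘ suc)

total-0 : {f : Fin n → ℕ} → (∀ i → f i ≡ 0) → total f ≡ 0
total-0 {zero} e = refl
total-0 {suc n} e = cong₂ _+_ (e zero) (total-0 (e ∘ suc))

total-swap : (f : Fin m → Fin n → ℕ) → total (λ i → total (f i)) ≡ total (λ j → total (λ i → f i j))
total-swap {zero} {n} f = sym (total-0 {n} (λ _ → refl))
total-swap {suc m} f = trans (cong (total (f zero) +_) (total-swap (f ∘ suc))) (sym (total-+ (f zero) _))

term≤total : ∀ (f : Fin n → ℕ) i → f i ≤ total f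
term≤total f zero = m≤m+n (f zero) _
term≤total f (suc i) = ≤-trans (term≤total (f ∘ suc) i) (m≤n+m _ (f zero))

term≤above : ∀ x (f : Fin n → ℕ) i → x ≤ toℕ i → f i ≤ above x f
term≤above zero f i _ = term≤total f i
term≤above (suc x) f (suc i) (s≤s x≤i) = term≤above x (f ∘ suc) i x≤i

term≤below : ∀ x (f : Fin n → ℕ) i → toℕ i < x → f i ≤ below x f
term≤below (suc x) f zero _ = m≤m+n (f zero) _
term≤below (suc x) f (suc i) (s≤s i<x) = ≤-trans (term≤below x (f ∘ suc) i i<x) (m≤n+m _ (f zero))

below-suc : ∀ (f : Fin n → ℕ) i → below (suc (toℕ i)) f ≡ below (toℕ i) f + f i
below-suc f zero = +-comm (f zero) 0
below-suc f (suc i) = trans (cong (f zero +_) (below-suc (f ∘ suc) i)) (sym (+-assoc (f zero) _ _))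

below≤total : ∀ x (f : Fin n → ℕ) → below x f ≤ total f
below≤total x f = subst (below x f ≤_) (below+above x f) (m≤m+n _ _)

total⇒∃ : ∀ (f : Fin n → ℕ) → 1 ≤ total f → ∃ λ i → 1 ≤ f i
total⇒∃ {suc n} f t with f zero in e
... | suc _ = zero , subst (1 ≤_) (sym e) (s≤s z≤n)
... | zero with total⇒∃ (f ∘ suc) t
... | i , p = suc i , p

below⇒∃ : ∀ x (f : Fin n → ℕ) → 1 ≤ below x f → ∃ λ i → toℕ i < x × 1 ≤ f i
below⇒∃ {suc n} (suc x) f t with f zero in e
... | suc _ = zero , s≤s z≤n , subst (1 ≤_) (sym e) (s≤s z≤n)
... | zero with below⇒∃ x (f ∘ suc) t
... | i , i<x , p = suc i , s≤s i<x , p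

total-squeeze : ∀ {f g : Fin n → ℕ} → (∀ i → g i ≤ f i) → total f ≡ total g → ∀ i → f i ≡ g i
total-squeeze {f = f} {g} b e i = ≤-antisym (squeeze b (≤-reflexive e) i) (b i)
  where
  squeeze : ∀ {n} {f g : Fin n → ℕ} → (∀ i → g i ≤ f i) → total f ≤ total g → ∀ i → f i ≤ g i
  squeeze {f = f} {g} b e zero =
    +-cancelʳ-≤ (total (f ∘ suc)) _ _ (≤-trans e (+-monoʳ-≤ (g zero) (total-mono (b ∘ suc))))
  squeeze {f = f} {g} b e (suc i) = squeeze (b ∘ suc)
    (+-cancelˡ-≤ (f zero) _ _ (≤-trans e (+-monoˡ-≤ _ (b zero)))) i

below-cong : ∀ x {f g : Fin n → ℕ} → (∀ i → f i ≡ g i) → below x f ≡ below x g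
below-cong zero e = refl
below-cong {zero} (suc x) e = refl
below-cong {suc n} (suc x) e = cong₂ _+_ (e zero) (below-cong x (e ∘ suc))

below-+ : ∀ x (f g : Fin n → ℕ) → below x (λ i → f i + g i) ≡ below x f + below x g
below-+ zero f g = refl
below-+ {zero} (suc x) f g = refl
below-+ {suc n} (suc x) f g = trans (cong (f zero + g zero +_) (below-+ x (f ∘ suc) (g ∘ suc)))
  (interchange (f zero) (g zero) _ _)

below-n : (f : Fin n → ℕ) → below n f ≡ total f
below-n {zero} f = refl
below-n {suc n} f = cong (f zero +_) (below-n (f ∘ suc))

below-mono : ∀ x {f g : Fin n → ℕ} → (∀ i → f i ≤ g i) → below x f ≤ below x g
below-mono zero b = z≤n
below-mono {zero} (suc x) b = z≤n
below-mono {suc n} (suc x) b = +-mono-≤ (b zero) (below-mono x (b ∘ suc))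

total-unique : ∀ (f : Fin n → ℕ) s t → total f ≤ 1 → 1 ≤ f s → 1 ≤ f t → s ≡ t
total-unique f zero zero _ _ _ = refl
total-unique f zero (suc t) f≤1 p q =
  ⊥-elim (1+n≰n (≤-trans (+-mono-≤ p (≤-trans q (term≤total (f ∘ suc) t))) f≤1))
total-unique f (suc s) zero f≤1 p q =
  ⊥-elim (1+n≰n (≤-trans (+-mono-≤ q (≤-trans p (term≤total (f ∘ suc) s))) f≤1))
total-unique f (suc s) (suc t) f≤1 p q = cong suc (total-unique (f ∘ suc) s t (m+n≤o⇒n≤o (f zero) f≤1) p q)

below-monoˡ : ∀ {x y} {f : Fin n → ℕ} → x ≤ y → below x f ≤ below y f
below-monoˡ z≤n = z≤n
below-monoˡ {zero} (s≤s x≤y) = z≤n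
below-monoˡ {suc n} {f = f} (s≤s x≤y) = +-monoʳ-≤ (f zero) (below-monoˡ x≤y)

bits : Vec Bool n → Fin n → ℕ
bits V i = b2n (lookup V i)

size : Vec Bool n → ℕ
size V = total (bits V)

-- Sorting the columns

-- The new left column consists of `C` and the unmatched cells of `X`. Matched cells are equally
-- many on both sides, so the size is that of `X` plus the unmatched cells of `C`.
size-swapˡ : (C X : Vec Bool n) → size (swapˡ C X) ≡ surplus C X + size X
size-swapˡ [] [] = refl
size-swapˡ (c ∷ C) (x ∷ X) rewrite size-swapˡ C X = row c x (surplus C X)
  where
  row : ∀ c x k → b2n (fst (emit c x k)) + (k + size X) ≡ next (emit c x k) + (b2n x + size X)
  row false false k = refl
  row true true k = sym (+-suc k (size X))
  row true false k = refl
  row false true zero = refl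
  row false true (suc k) = sym (+-suc k (size X))

size-swapʳ : (C X : Vec Bool n) → size (swapʳ C X) + surplus C X ≡ size C
size-swapʳ [] [] = refl
size-swapʳ (c ∷ C) (x ∷ X) rewrite sym (size-swapʳ C X) = row c x (surplus C X)
  where
  s = size (swapʳ C X)
  row : ∀ c x k → b2n (snd (emit c x k)) + s + next (emit c x k) ≡ b2n c + (s + k)
  row false false k = refl
  row true true k = refl
  row true false k = +-suc s k
  row false true zero = refl
  row false true (suc k) = sym (+-suc s k)

slide : Vec Bool n → Vec (Vec Bool n) m → Vec (Vec Bool n) m
slide C [] = []
slide C (X ∷ Xs) = swapˡ C X ∷ slide (swapʳ C X) Xs

out : Vec Bool n → Vec (Vec Bool n) m → Vec Bool n
out C [] = C
out C (X ∷ Xs) = out (swapʳ C X) Xs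

-- In a lock diagram the leftmost column is a smallest one, so it is carried past all others. Slid
-- first and sorted afterwards, the columns leave `out C Cs` in last place, and bringing it back to
-- the far left returns `C`.
sort : Vec (Vec Bool n) m → Vec (Vec Bool n) m
sort [] = []
sort (C ∷ Cs) = sort (slide C Cs) ∷ʳ out C Cs

Matched : Vec Bool n → Vec (Vec Bool n) m → Set
Matched C [] = ⊤
Matched C (X ∷ Xs) = surplus C X ≡ 0 × Matched (swapʳ C X) Xs

AllMatched : Vec (Vec Bool n) m → Set
AllMatched [] = ⊤
AllMatched (C ∷ Cs) = Matched C Cs × AllMatched (slide C Cs)

backˡ-inverse₀ : (C X : Vec Bool n) → surplus C X ≡ 0 → backˡ 0 (swapˡ C X) (swapʳ C X) ≡ C
backˡ-inverse₀ C X e = subst (λ k → backˡ k (swapˡ C X) (swapʳ C X) ≡ C) e (backˡ-inverse C X)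

backʳ-inverse₀ : (C X : Vec Bool n) → surplus C X ≡ 0 → backʳ 0 (swapˡ C X) (swapʳ C X) ≡ X
backʳ-inverse₀ C X e = subst (λ k → backʳ k (swapˡ C X) (swapʳ C X) ≡ X) e (backʳ-inverse C X)

slide-injective : ∀ (C C' : Vec Bool n) (Cs Cs' : Vec (Vec Bool n) m) →
  Matched C Cs → Matched C' Cs' → slide C Cs ≡ slide C' Cs' → out C Cs ≡ out C' Cs' →
  C ∷ Cs ≡ C' ∷ Cs'
slide-injective C C' [] [] _ _ _ e = cong (_∷ []) e
slide-injective C C' (X ∷ Xs) (X' ∷ Xs') (m , ms) (m' , ms') e e'
  with slide-injective (swapʳ C X) (swapʳ C' X') Xs Xs' ms ms' (cong Vec.tail e) e'
... | f = cong₂ _∷_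
      (trans (sym (backˡ-inverse₀ C X m)) (trans (cong₂ (backˡ 0) (cong Vec.head e) (cong Vec.head f))
          (backˡ-inverse₀ C' X' m')))
      (cong₂ _∷_
        (trans (sym (backʳ-inverse₀ C X m)) (trans (cong₂ (backʳ 0) (cong Vec.head e) (cong Vec.head f))
          (backʳ-inverse₀ C' X' m')))
        (cong Vec.tail f))

sort-injective : ∀ (Cs Cs' : Vec (Vec Bool n) m) → AllMatched Cs → AllMatched Cs' →
  sort Cs ≡ sort Cs' → Cs ≡ Cs'
sort-injective [] [] _ _ _ = refl
sort-injective (C ∷ Cs) (C' ∷ Cs') (ms , am) (ms' , am') e with ∷ʳ-injective _ _ e
... | e₁ , e₂ = slide-injective C C' Cs Cs' ms ms' (sort-injective _ _ am am' e₁) e₂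

rowCount-∷ʳ : ∀ (r : Fin n) (Cs : Vec (Vec Bool n) m) C → rowCount r (Cs ∷ʳ C) ≡ rowCount r Cs + bits C r
rowCount-∷ʳ r [] C = +-comm (bits C r) 0
rowCount-∷ʳ r (X ∷ Xs) C = trans (cong (bits X r +_) (rowCount-∷ʳ r Xs C)) (sym (+-assoc (bits X r) _ _))

bits-swapˡ+swapʳ : ∀ (C X : Vec Bool n) r → bits (swapˡ C X) r + bits (swapʳ C X) r ≡ bits C r + bits X r
bits-swapˡ+swapʳ (c ∷ C) (x ∷ X) (suc r) = bits-swapˡ+swapʳ C X r
bits-swapˡ+swapʳ (c ∷ C) (x ∷ X) zero = row c x (surplus C X)
  where
  row : ∀ c x k → b2n (fst (emit c x k)) + b2n (snd (emit c x k)) ≡ b2n c + b2n x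
  row false false k = refl
  row true true k = refl
  row true false k = refl
  row false true zero = refl
  row false true (suc k) = refl

rowCount-slide : ∀ r (C : Vec Bool n) (Cs : Vec (Vec Bool n) m) →
  rowCount r (slide C Cs) + bits (out C Cs) r ≡ bits C r + rowCount r Cs
rowCount-slide r C [] = +-comm 0 (bits C r)
rowCount-slide r C (X ∷ Xs) = begin
  bits (swapˡ C X) r + rowCount r (slide (swapʳ C X) Xs) + bits (out (swapʳ C X) Xs) r
    ≡⟨ +-assoc (bits (swapˡ C X) r) _ _ ⟩
  bits (swapˡ C X) r + (rowCount r (slide (swapʳ C X) Xs) + bits (out (swapʳ C X) Xs) r)
    ≡⟨ cong (bits (swapˡ C X) r +_) (rowCount-slide r (swapʳ C X) Xs) ⟩
  bits (swapˡ C X) r + (bits (swapʳ C X) r + rowCount r Xs)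
    ≡⟨ +-assoc (bits (swapˡ C X) r) _ _ ⟨
  bits (swapˡ C X) r + bits (swapʳ C X) r + rowCount r Xs
    ≡⟨ cong (_+ rowCount r Xs) (bits-swapˡ+swapʳ C X r) ⟩
  bits C r + bits X r + rowCount r Xs
    ≡⟨ +-assoc (bits C r) _ _ ⟩
  bits C r + (bits X r + rowCount r Xs) ∎
  where open ≡-Reasoning

rowCount-sort : ∀ r (Cs : Vec (Vec Bool n) m) → rowCount r (sort Cs) ≡ rowCount r Cs
rowCount-sort r [] = refl
rowCount-sort r (C ∷ Cs) = begin
  rowCount r (sort (slide C Cs) ∷ʳ out C Cs)      ≡⟨ rowCount-∷ʳ r (sort (slide C Cs)) (out C Cs) ⟩
  rowCount r (sort (slide C Cs)) + bits (out C Cs) r ≡⟨ cong (_+ bits (out C Cs) r) (rowCount-sort r (slide C Cs)) ⟩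
  rowCount r (slide C Cs) + bits (out C Cs) r     ≡⟨ rowCount-slide r C Cs ⟩
  bits C r + rowCount r Cs                        ∎
  where open ≡-Reasoning

-- Columns brought to the far left

foldBack : Vec (Vec Bool n) m → Vec Bool n → Vec Bool n
foldBack [] V = V
foldBack (U ∷ Us) V = backˡ 0 U (foldBack Us V)

foldBack-∷ʳ : ∀ (Us : Vec (Vec Bool n) m) U V → foldBack (Us ∷ʳ U) V ≡ foldBack Us (backˡ 0 U V)
foldBack-∷ʳ [] U V = refl
foldBack-∷ʳ (W ∷ Us) U V = cong (backˡ 0 W) (foldBack-∷ʳ Us U V)

-- Each swap of the slide is one use of the exchange law; `Matched` lets `backˡ` and `backʳ` restore
-- the pair as it was before the swap.
foldBack-slide : ∀ (C : Vec Bool n) (Cs : Vec (Vec Bool n) m) V → Matched C Cs →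
  foldBack (slide C Cs) (backˡ 0 (out C Cs) V) ≡ backˡ 0 C (foldBack Cs V)
foldBack-slide C [] V _ = refl
foldBack-slide C (X ∷ Xs) V (m , ms) = begin
  backˡ 0 (swapˡ C X) (foldBack (slide (swapʳ C X) Xs) (backˡ 0 (out (swapʳ C X) Xs) V))
    ≡⟨ cong (backˡ 0 (swapˡ C X)) (foldBack-slide (swapʳ C X) Xs V ms) ⟩
  backˡ 0 (swapˡ C X) (backˡ 0 (swapʳ C X) (foldBack Xs V))
    ≡⟨ backˡ-braid (swapˡ C X) (swapʳ C X) (foldBack Xs V) ⟩
  backˡ 0 (backˡ 0 (swapˡ C X) (swapʳ C X)) (backˡ 0 (backʳ 0 (swapˡ C X) (swapʳ C X)) (foldBack Xs V))
    ≡⟨ cong₂ (λ A B → backˡ 0 A (backˡ 0 B (foldBack Xs V))) (backˡ-inverse₀ C X m) (backʳ-inverse₀ C X m) ⟩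
  backˡ 0 C (backˡ 0 X (foldBack Xs V)) ∎
  where open ≡-Reasoning

foldBack-slide-out : ∀ (C : Vec Bool n) (Cs : Vec (Vec Bool n) m) → Matched C Cs →
  foldBack (slide C Cs) (out C Cs) ≡ C
foldBack-slide-out C [] _ = refl
foldBack-slide-out C (X ∷ Xs) (m , ms) =
  trans (cong (backˡ 0 (swapˡ C X)) (foldBack-slide-out (swapʳ C X) Xs ms)) (backˡ-inverse₀ C X m)

foldBack-sort : ∀ (Cs : Vec (Vec Bool n) m) V → AllMatched Cs → foldBack (sort Cs) V ≡ foldBack Cs V
foldBack-sort [] V _ = refl
foldBack-sort (C ∷ Cs) V (ms , am) = begin
  foldBack (sort (slide C Cs) ∷ʳ out C Cs) V      ≡⟨ foldBack-∷ʳ (sort (slide C Cs)) (out C Cs) V ⟩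
  foldBack (sort (slide C Cs)) (backˡ 0 (out C Cs) V) ≡⟨ foldBack-sort (slide C Cs) _ am ⟩
  foldBack (slide C Cs) (backˡ 0 (out C Cs) V)        ≡⟨ foldBack-slide C Cs V ms ⟩
  backˡ 0 C (foldBack Cs V)                           ∎
  where open ≡-Reasoning

-- K c is the set of labels that the content allows in column c (numbered from 0) of a key tableau.  In a
-- lock tableau the column followed by m further ones has label set K m, hence the index in LockBound.
module Contents (K : ℕ → Vec Bool n) where

  -- `f` is the composite of the swaps that bring the column at hand to the far left, past the
  -- columns already read. Comparing the numbers of cells from each row up is the componentwise
  -- comparison of columns of equal size.
  LockBound : (Vec Bool n → Vec Bool n) → Vec (Vec Bool n) m → Set
  LockBound f [] = ⊤
  LockBound {m = suc m} f (C ∷ Cs) =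
    (∀ r → above r (bits (f C)) ≤ above r (bits (K m))) × LockBound (f ∘ swapˡ C) Cs

  -- In a sorted diagram a column moves left past columns at least as large, so the inverse swap is
  -- used. For equal sizes the counts `below` express the same comparison as the complementary
  -- counts `above`.
  KeyBound : (Vec Bool n → Vec Bool n) → ℕ → Vec (Vec Bool n) m → Set
  KeyBound f c [] = ⊤
  KeyBound f c (V ∷ Vs) =
    (∀ x → below x (bits (K c)) ≤ below x (bits (f V))) × KeyBound (f ∘ backˡ 0 V) (suc c) Vs

  LockSizes : Vec (Vec Bool n) m → Set
  LockSizes [] = ⊤
  LockSizes {m = suc m} (C ∷ Cs) = size C ≡ size (K m) × LockSizes Cs

  KeySizes : ℕ → Vec (Vec Bool n) m → Set
  KeySizes c [] = ⊤
  KeySizes c (V ∷ Vs) = size V ≡ size (K c) × KeySizes (suc c) Vs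

  LockBound-cong : ∀ f g → (∀ V → f V ≡ g V) → (Cs : Vec (Vec Bool n) m) →
    LockBound f Cs → LockBound g Cs
  LockBound-cong f g eq [] _ = tt
  LockBound-cong {m = suc m} f g eq (C ∷ Cs) (b , bs) =
    (λ r → subst (λ V → above r (bits V) ≤ above r (bits (K m))) (eq C) (b r)) ,
    LockBound-cong (f ∘ swapˡ C) (g ∘ swapˡ C) (λ V → eq (swapˡ C V)) Cs bs

  -- A later column comes out the same whether it passes `C` and `X` or the swapped pair, so the
  -- bounds survive when `C` is carried away.
  LockBound-slide : ∀ f C (Cs : Vec (Vec Bool n) m) → LockBound (f ∘ swapˡ C) Cs → LockBound f (slide C Cs)
  LockBound-slide f C [] _ = tt
  LockBound-slide f C (X ∷ Xs) (b , bs) = b ,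
    LockBound-slide (f ∘ swapˡ (swapˡ C X)) (swapʳ C X) Xs (LockBound-cong _ _ (λ V → cong f (swapˡ-braid C X V)) Xs bs)

  Expansive : (Vec Bool n → Vec Bool n) → Set
  Expansive f = ∀ V → size V ≤ size (f V)

  swapˡ-expansive : ∀ C → Expansive (swapˡ C)
  swapˡ-expansive C V = subst (size V ≤_) (sym (size-swapˡ C V)) (m≤n+m (size V) (surplus C V))

  -- Passing `C` enlarges `X` by the number of unmatched cells of `C`, and further swaps never
  -- shrink a column. The bound at row 0 caps the final size by that of `X`, so every cell of `C` is
  -- matched.
  LockBound⇒Matched : ∀ f C (Cs : Vec (Vec Bool n) m) → Expansive f → LockBound (f ∘ swapˡ C) Cs →
    LockSizes Cs → Matched C Cs
  LockBound⇒Matched f C [] _ _ _ = tt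
  LockBound⇒Matched {m = suc m} f C (X ∷ Xs) ex (b , bs) (s , ss) =
    n≤0⇒n≡0 (+-cancelʳ-≤ (size X) _ _ cnt-bound) ,
    LockBound⇒Matched (f ∘ swapˡ (swapˡ C X)) (swapʳ C X) Xs (λ V → ≤-trans (swapˡ-expansive (swapˡ C X) V) (ex _))
      (LockBound-cong _ _ (λ V → cong f (swapˡ-braid C X V)) Xs bs) ss
    where
    cnt-bound : surplus C X + size X ≤ 0 + size X
    cnt-bound = begin
      surplus C X + size X ≡⟨ size-swapˡ C X ⟨
      size (swapˡ C X)     ≤⟨ ex (swapˡ C X) ⟩
      size (f (swapˡ C X)) ≤⟨ b 0 ⟩
      size (K m)       ≡⟨ s ⟨
      size X           ∎
      where open ≤-Reasoning

  size-swapˡ₀ : ∀ (C X : Vec Bool n) → surplus C X ≡ 0 → size (swapˡ C X) ≡ size X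
  size-swapˡ₀ C X e = trans (size-swapˡ C X) (cong (_+ size X) e)

  size-swapʳ₀ : ∀ (C X : Vec Bool n) → surplus C X ≡ 0 → size (swapʳ C X) ≡ size C
  size-swapʳ₀ C X e = trans (sym (+-identityʳ _)) (trans (cong (size (swapʳ C X) +_) (sym e)) (size-swapʳ C X))

  LockSizes-slide : ∀ C (Cs : Vec (Vec Bool n) m) → Matched C Cs → LockSizes Cs → LockSizes (slide C Cs)
  LockSizes-slide C [] _ _ = tt
  LockSizes-slide C (X ∷ Xs) (m , ms) (s , ss) =
    trans (size-swapˡ₀ C X m) s , LockSizes-slide (swapʳ C X) Xs ms ss

  size-out : ∀ C (Cs : Vec (Vec Bool n) m) → Matched C Cs → size (out C Cs) ≡ size C
  size-out C [] _ = refl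
  size-out C (X ∷ Xs) (m , ms) = trans (size-out (swapʳ C X) Xs ms) (size-swapʳ₀ C X m)

  LockBound⇒AllMatched : (Cs : Vec (Vec Bool n) m) → LockBound id Cs → LockSizes Cs → AllMatched Cs
  LockBound⇒AllMatched [] _ _ = tt
  LockBound⇒AllMatched (C ∷ Cs) (_ , bs) (_ , ss) =
    ms , LockBound⇒AllMatched (slide C Cs) (LockBound-slide id C Cs bs) (LockSizes-slide C Cs ms ss)
    where ms = LockBound⇒Matched id C Cs (λ _ → ≤-refl) bs ss

  KeySizes-∷ʳ : ∀ c (Vs : Vec (Vec Bool n) m) V → KeySizes c Vs → size V ≡ size (K (m + c)) → KeySizes c (Vs ∷ʳ V)
  KeySizes-∷ʳ c [] V _ s = s , tt
  KeySizes-∷ʳ {m = suc m} c (U ∷ Vs) V (s' , ss) s =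
    s' , KeySizes-∷ʳ (suc c) Vs V ss (trans s (cong (size ∘ K) (sym (+-suc m c))))

  KeyBound-∷ʳ : ∀ f c (Vs : Vec (Vec Bool n) m) V → KeyBound f c Vs →
    (∀ x → below x (bits (K (m + c))) ≤ below x (bits (f (foldBack Vs V)))) → KeyBound f c (Vs ∷ʳ V)
  KeyBound-∷ʳ f c [] V _ b = b , tt
  KeyBound-∷ʳ {m = suc m} f c (U ∷ Vs) V (b' , bs) b =
    b' , KeyBound-∷ʳ (f ∘ backˡ 0 U) (suc c) Vs V bs
      (subst (λ k → ∀ x → below x (bits (K k)) ≤ below x (bits (f (backˡ 0 U (foldBack Vs V)))))
             (sym (+-suc m c)) b)

  sort-KeySizes : (Cs : Vec (Vec Bool n) m) → LockSizes Cs → AllMatched Cs → KeySizes 0 (sort Cs)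
  sort-KeySizes [] _ _ = tt
  sort-KeySizes {m = suc m} (C ∷ Cs) (s , ss) (ms , am) =
    KeySizes-∷ʳ 0 (sort (slide C Cs)) (out C Cs)
      (sort-KeySizes (slide C Cs) (LockSizes-slide C Cs ms ss) am)
      (trans (size-out C Cs ms) (trans s (cong (size ∘ K) (sym (+-identityʳ m)))))

  above⇒below : ∀ {f g : Fin n → ℕ} → total f ≡ total g → (∀ r → above r f ≤ above r g) →
    ∀ x → below x g ≤ below x f
  above⇒below {f} {g} e b x = +-cancelʳ-≤ (above x f) _ _ (begin
    below x g + above x f ≤⟨ +-monoʳ-≤ (below x g) (b x) ⟩
    below x g + above x g ≡⟨ below+above x g ⟩
    total g               ≡⟨ e ⟨
    total f               ≡⟨ below+above x f ⟨
    below x f + above x f ∎)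
    where open ≤-Reasoning

  -- The last sorted column, brought back past the others, is `C` itself, so its bound is the head
  -- of `LockBound`. The other columns are treated by induction on the slid diagram.
  sort-KeyBound : (Cs : Vec (Vec Bool n) m) → LockBound id Cs → LockSizes Cs → AllMatched Cs →
    KeyBound id 0 (sort Cs)
  sort-KeyBound [] _ _ _ = tt
  sort-KeyBound {m = suc m} (C ∷ Cs) (b , bs) (s , ss) (ms , am) =
    KeyBound-∷ʳ id 0 (sort (slide C Cs)) (out C Cs)
      (sort-KeyBound (slide C Cs) (LockBound-slide id C Cs bs) (LockSizes-slide C Cs ms ss) am)
      (subst₂ (λ k V → ∀ x → below x (bits (K k)) ≤ below x (bits V)) (sym (+-identityʳ m))
        (sym (trans (foldBack-sort (slide C Cs) (out C Cs) am) (foldBack-slide-out C Cs ms)))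
        (above⇒below s b))

-- Raising operators commute with sorting

pass : Bool → Bool → ℕ → ℕ
pass true false o = suc o
pass false true o = pred o
pass true true o = o
pass false false o = o

free : Bool → Bool → ℕ → Bool
free false true zero = true
free _ _ _ = false

passCol : ℕ → Vec Bool n → ℕ → ℕ
passCol j C = pass (cellAt C j) (cellAt C (suc j))

lower : ℕ → ℕ → Vec Bool n → Maybe (Vec Bool n)
lower j o C = if free (cellAt C j) (cellAt C (suc j)) o then just (moveDown (suc j) C) else nothing

-- eD (suc j), for o unpaired cells of the lower row to the left of the given columns.
raise : ℕ → ℕ → Vec (Vec Bool n) m → Maybe (Vec (Vec Bool n) m)
raise j o [] = nothing
raise j o (C ∷ Cs) = maybe′ (just ∘ (C ∷_)) (Maybe.map (_∷ Cs) (lower j o C)) (raise j (passCol j C o) Cs)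

raise₂ : ℕ → ℕ → Vec Bool n → Vec Bool n → Maybe (Vec Bool n × Vec Bool n)
raise₂ j o C X = maybe′ (just ∘ (C ,_)) (Maybe.map (_, X) (lower j o C)) (lower j (passCol j C o) X)

-- The counter belongs to the result because the rows underneath see the rows above only through it.
-- Its invariance lets `raise₂-swap` extend the commutation to columns with further rows below.
swap : Vec Bool n × Vec Bool n → ℕ × Vec Bool n × Vec Bool n
swap (C , X) = surplus C X , swapˡ C X , swapʳ C X

lower-∷ : ∀ j o c (C : Vec Bool n) → lower (suc j) o (c ∷ C) ≡ Maybe.map (c ∷_) (lower j o C)
lower-∷ j o c C with free (cellAt C j) (cellAt C (suc j)) o
... | true = refl
... | false = refl

raise₂-∷ : ∀ j o c x (C X : Vec Bool n) →
  raise₂ (suc j) o (c ∷ C) (x ∷ X) ≡ Maybe.map (λ (C' , X') → c ∷ C' , x ∷ X') (raise₂ j o C X)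
raise₂-∷ j o c x C X rewrite lower-∷ j o c C | lower-∷ j (passCol j C o) x X
  with lower j (passCol j C o) X | lower j o C
... | just _ | _ = refl
... | nothing | just _ = refl
... | nothing | nothing = refl

-- A raising operator touches two rows only, which leaves sixteen bit patterns, split by the counter
-- `k` from the rows above and the number `o` of unpaired cells to the left. By the second component
-- the columns further right meet the same number of unpaired cells before and after the swap.
raise₂-swap-base : ∀ k o c₀ c₁ x₀ x₁ (C X : Vec Bool n) → surplus C X ≡ k →
  let C₊ = c₀ ∷ c₁ ∷ C ; X₊ = x₀ ∷ x₁ ∷ X in
  Maybe.map swap (raise₂ 0 o C₊ X₊) ≡
    Maybe.map (surplus C₊ X₊ ,_) (raise₂ 0 o (swapˡ C₊ X₊) (swapʳ C₊ X₊))
  × passCol 0 X₊ (passCol 0 C₊ o) ≡ passCol 0 (swapʳ C₊ X₊) (passCol 0 (swapˡ C₊ X₊) o)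
raise₂-swap-base k o false false false false C X _ = refl , refl
raise₂-swap-base 0 0 false false false true C X e rewrite e = refl , refl
raise₂-swap-base 0 (suc o) false false false true C X e rewrite e = refl , refl
raise₂-swap-base (suc k) 0 false false false true C X e rewrite e = refl , refl
raise₂-swap-base (suc k) (suc o) false false false true C X e rewrite e = refl , refl
raise₂-swap-base 0 o false false true false C X e rewrite e = refl , refl
raise₂-swap-base (suc k) o false false true false C X e rewrite e = refl , refl
raise₂-swap-base 0 o false false true true C X e rewrite e = refl , refl
raise₂-swap-base 1 o false false true true C X e rewrite e = refl , refl
raise₂-swap-base (suc (suc k)) o false false true true C X e rewrite e = refl , refl
raise₂-swap-base k 0 false true false false C X e rewrite e = refl , refl
raise₂-swap-base k (suc o) false true false false C X _ = refl , refl
raise₂-swap-base k 0 false true false true C X e rewrite e = refl , refl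
raise₂-swap-base k 1 false true false true C X e rewrite e = refl , refl
raise₂-swap-base k (suc (suc o)) false true false true C X _ = refl , refl
raise₂-swap-base k 0 false true true false C X e rewrite e = refl , refl
raise₂-swap-base k (suc o) false true true false C X _ = refl , refl
raise₂-swap-base 0 0 false true true true C X e rewrite e = refl , refl
raise₂-swap-base 0 (suc o) false true true true C X e rewrite e = refl , refl
raise₂-swap-base (suc k) 0 false true true true C X e rewrite e = refl , refl
raise₂-swap-base (suc k) (suc o) false true true true C X e rewrite e = refl , refl
raise₂-swap-base k o true false false false C X _ = refl , refl
raise₂-swap-base 0 o true false false true C X e rewrite e = refl , refl
raise₂-swap-base (suc k) o true false false true C X e rewrite e = refl , refl
raise₂-swap-base k o true false true false C X _ = refl , refl
raise₂-swap-base 0 o true false true true C X e rewrite e = refl , refl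
raise₂-swap-base (suc k) o true false true true C X e rewrite e = refl , refl
raise₂-swap-base k o true true false false C X _ = refl , refl
raise₂-swap-base k 0 true true false true C X e rewrite e = refl , refl
raise₂-swap-base k (suc o) true true false true C X _ = refl , refl
raise₂-swap-base k o true true true false C X _ = refl , refl
raise₂-swap-base k o true true true true C X _ = refl , refl

raise₂-swap : ∀ j o (C X : Vec Bool n) → suc j < n →
  Maybe.map swap (raise₂ j o C X) ≡ Maybe.map (surplus C X ,_) (raise₂ j o (swapˡ C X) (swapʳ C X))
raise₂-swap zero o (c₀ ∷ c₁ ∷ C) (x₀ ∷ x₁ ∷ X) _ =
  proj₁ (raise₂-swap-base (surplus C X) o c₀ c₁ x₀ x₁ C X refl)
raise₂-swap zero o (_ ∷ []) (_ ∷ []) (s≤s ())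
raise₂-swap (suc j) o (c ∷ C) (x ∷ X) (s≤s j<n)
  rewrite raise₂-∷ j o c x C X
        | raise₂-∷ j o (fst (emit c x (surplus C X))) (snd (emit c x (surplus C X))) (swapˡ C X) (swapʳ C X)
  with raise₂ j o C X | raise₂ j o (swapˡ C X) (swapʳ C X) | raise₂-swap j o C X j<n
... | nothing | nothing | _ = refl
... | just _ | just _ | e = cong (Maybe.map grow) e
  where
  grow : ∀ {n} → ℕ × Vec Bool n × Vec Bool n → ℕ × Vec Bool (suc n) × Vec Bool (suc n)
  grow (k , A , B) = next (emit c x k) , fst (emit c x k) ∷ A , snd (emit c x k) ∷ B

passCol-swap : ∀ j o (C X : Vec Bool n) → suc j < n →
  passCol j X (passCol j C o) ≡ passCol j (swapʳ C X) (passCol j (swapˡ C X) o)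
passCol-swap zero o (c₀ ∷ c₁ ∷ C) (x₀ ∷ x₁ ∷ X) _ =
  proj₂ (raise₂-swap-base (surplus C X) o c₀ c₁ x₀ x₁ C X refl)
passCol-swap zero o (_ ∷ []) (_ ∷ []) (s≤s ())
passCol-swap (suc j) o (c ∷ C) (x ∷ X) (s≤s j<n) = passCol-swap j o C X j<n

raise-pair : ∀ j o (C X : Vec Bool n) (Xs : Vec (Vec Bool n) m) →
  raise j o (C ∷ X ∷ Xs) ≡
  maybe′ (λ Xs' → just (C ∷ X ∷ Xs')) (Maybe.map (λ (C' , X') → C' ∷ X' ∷ Xs) (raise₂ j o C X))
    (raise j (passCol j X (passCol j C o)) Xs)
raise-pair j o C X Xs
  with raise j (passCol j X (passCol j C o)) Xs | lower j (passCol j C o) X | lower j o C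
... | just _  | _       | _       = refl
... | nothing | just _  | _       = refl
... | nothing | nothing | just _  = refl
... | nothing | nothing | nothing = refl

swapHead : Vec (Vec Bool n) (suc (suc m)) → Vec (Vec Bool n) (suc (suc m))
swapHead (C ∷ X ∷ Xs) = swapˡ C X ∷ swapʳ C X ∷ Xs

raise-swapHead : ∀ j o → suc j < n → (Cs : Vec (Vec Bool n) (suc (suc m))) →
  raise j o (swapHead Cs) ≡ Maybe.map swapHead (raise j o Cs)
raise-swapHead j o j<n (C ∷ X ∷ Xs)
  rewrite raise-pair j o C X Xs | raise-pair j o (swapˡ C X) (swapʳ C X) Xs | passCol-swap j o C X j<n
  with raise j (passCol j (swapʳ C X) (passCol j (swapˡ C X) o)) Xs
... | just _ = refl
... | nothing
  with raise₂ j o C X | raise₂ j o (swapˡ C X) (swapʳ C X) | raise₂-swap j o C X j<n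
... | nothing | nothing | _ = refl
... | just _ | just _ | e = cong (Maybe.map (λ (_ , A , B) → A ∷ B ∷ Xs)) (sym e)

shift : Vec (Vec Bool n) (suc m) → Vec (Vec Bool n) (suc m)
shift (C ∷ Cs) = slide C Cs ∷ʳ out C Cs

raise-shift : ∀ j o → suc j < n → (Cs : Vec (Vec Bool n) (suc m)) →
  raise j o (shift Cs) ≡ Maybe.map shift (raise j o Cs)
raise-shift j o j<n (C ∷ []) with lower j o C
... | just _ = refl
... | nothing = refl
raise-shift j o j<n (C ∷ X ∷ Xs) = begin
  raise j o (swapˡ C X ∷ shift (swapʳ C X ∷ Xs))
    ≡⟨ tail-step ⟩
  Maybe.map shiftTail (raise j o (swapHead (C ∷ X ∷ Xs)))
    ≡⟨ cong (Maybe.map shiftTail) (raise-swapHead j o j<n (C ∷ X ∷ Xs)) ⟩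
  Maybe.map shiftTail (Maybe.map swapHead (raise j o (C ∷ X ∷ Xs)))
    ≡⟨ Maybeₚ.map-∘ (raise j o (C ∷ X ∷ Xs)) ⟨
  Maybe.map (shiftTail ∘ swapHead) (raise j o (C ∷ X ∷ Xs))
    ≡⟨ Maybeₚ.map-cong (λ { (_ ∷ _ ∷ _) → refl }) (raise j o (C ∷ X ∷ Xs)) ⟩
  Maybe.map shift (raise j o (C ∷ X ∷ Xs)) ∎
  where
  open ≡-Reasoning
  shiftTail : ∀ {m n} → Vec (Vec Bool n) (suc (suc m)) → Vec (Vec Bool n) (suc (suc m))
  shiftTail (A ∷ As) = A ∷ shift As
  tail-step : raise j o (swapˡ C X ∷ shift (swapʳ C X ∷ Xs)) ≡
    Maybe.map shiftTail (raise j o (swapˡ C X ∷ swapʳ C X ∷ Xs))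
  tail-step rewrite raise-shift j (passCol j (swapˡ C X) o) j<n (swapʳ C X ∷ Xs)
    with raise j (passCol j (swapˡ C X) o) (swapʳ C X ∷ Xs) | lower j o (swapˡ C X)
  ... | just _  | _       = refl
  ... | nothing | just _  = refl
  ... | nothing | nothing = refl

passAll : ℕ → Vec (Vec Bool n) m → ℕ → ℕ
passAll j [] o = o
passAll j (C ∷ Cs) o = passAll j Cs (passCol j C o)

passAll-∷ʳ : ∀ j o (Cs : Vec (Vec Bool n) m) C → passAll j (Cs ∷ʳ C) o ≡ passCol j C (passAll j Cs o)
passAll-∷ʳ j o [] C = refl
passAll-∷ʳ j o (X ∷ Cs) C = passAll-∷ʳ j (passCol j X o) Cs C

passAll-slide : ∀ j o → suc j < n → (C : Vec Bool n) (Cs : Vec (Vec Bool n) m) →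
  passCol j (out C Cs) (passAll j (slide C Cs) o) ≡ passAll j Cs (passCol j C o)
passAll-slide j o j<n C [] = refl
passAll-slide j o j<n C (X ∷ Xs) =
  trans (passAll-slide j (passCol j (swapˡ C X) o) j<n (swapʳ C X) Xs)
        (cong (passAll j Xs) (sym (passCol-swap j o C X j<n)))

-- The column appended by `sort` sees those before it only through their number of unpaired
-- lower-row cells, so this number has to be invariant as well.
passAll-sort : ∀ j o → suc j < n → (Cs : Vec (Vec Bool n) m) → passAll j (sort Cs) o ≡ passAll j Cs o
passAll-sort j o j<n [] = refl
passAll-sort j o j<n (C ∷ Cs) = begin
  passAll j (sort (slide C Cs) ∷ʳ out C Cs) o        ≡⟨ passAll-∷ʳ j o (sort (slide C Cs)) (out C Cs) ⟩
  passCol j (out C Cs) (passAll j (sort (slide C Cs)) o)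
    ≡⟨ cong (passCol j (out C Cs)) (passAll-sort j o j<n (slide C Cs)) ⟩
  passCol j (out C Cs) (passAll j (slide C Cs) o)    ≡⟨ passAll-slide j o j<n C Cs ⟩
  passAll j Cs (passCol j C o)                       ∎
  where open ≡-Reasoning

raise-∷ʳ : ∀ j o (Cs : Vec (Vec Bool n) m) C → raise j o (Cs ∷ʳ C) ≡
  maybe′ (just ∘ (Cs ∷ʳ_)) (Maybe.map (_∷ʳ C) (raise j o Cs)) (lower j (passAll j Cs o) C)
raise-∷ʳ j o [] C with lower j o C
... | just _ = refl
... | nothing = refl
raise-∷ʳ j o (X ∷ Cs) C rewrite raise-∷ʳ j (passCol j X o) Cs C
  with lower j (passAll j Cs (passCol j X o)) C | raise j (passCol j X o) Cs | lower j o X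
... | just _  | _       | _       = refl
... | nothing | just _  | _       = refl
... | nothing | nothing | just _  = refl
... | nothing | nothing | nothing = refl

raise-sort : ∀ j o → suc j < n → (Cs : Vec (Vec Bool n) m) →
  raise j o (sort Cs) ≡ Maybe.map sort (raise j o Cs)
raise-sort j o j<n [] = refl
raise-sort {n = n} {m = suc m} j o j<n (C ∷ Cs) = begin
  raise j o (sort Zs ∷ʳ Z)
    ≡⟨ raise-∷ʳ j o (sort Zs) Z ⟩
  maybe′ (just ∘ (sort Zs ∷ʳ_)) (Maybe.map (_∷ʳ Z) (raise j o (sort Zs))) (lower j (passAll j (sort Zs) o) Z)
    ≡⟨ cong₂ (λ r k → maybe′ (just ∘ (sort Zs ∷ʳ_)) (Maybe.map (_∷ʳ Z) r) (lower j k Z))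
         (raise-sort j o j<n Zs) (passAll-sort j o j<n Zs) ⟩
  maybe′ (just ∘ (sort Zs ∷ʳ_)) (Maybe.map (_∷ʳ Z) (Maybe.map sort (raise j o Zs))) (lower j (passAll j Zs o) Z)
    ≡⟨ fuse ⟩
  Maybe.map sortInit (maybe′ (just ∘ (Zs ∷ʳ_)) (Maybe.map (_∷ʳ Z) (raise j o Zs)) (lower j (passAll j Zs o) Z))
    ≡⟨ cong (Maybe.map sortInit) (raise-∷ʳ j o Zs Z) ⟨
  Maybe.map sortInit (raise j o (shift (C ∷ Cs)))
    ≡⟨ cong (Maybe.map sortInit) (raise-shift j o j<n (C ∷ Cs)) ⟩
  Maybe.map sortInit (Maybe.map shift (raise j o (C ∷ Cs)))
    ≡⟨ Maybeₚ.map-∘ (raise j o (C ∷ Cs)) ⟨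
  Maybe.map (sortInit ∘ shift) (raise j o (C ∷ Cs))
    ≡⟨ Maybeₚ.map-cong (λ { (A ∷ As) → sortInit-∷ʳ (slide A As) (out A As) }) (raise j o (C ∷ Cs)) ⟩
  Maybe.map sort (raise j o (C ∷ Cs)) ∎
  where
  open ≡-Reasoning
  Zs = slide C Cs
  Z = out C Cs
  -- This presents `sort` as a function of the result of `shift`, so that the commutation with one
  -- pass and the induction hypothesis compose.
  sortInit : Vec (Vec Bool n) (suc m) → Vec (Vec Bool n) (suc m)
  sortInit As = sort (init As) ∷ʳ last As
  sortInit-∷ʳ : ∀ As A → sortInit (As ∷ʳ A) ≡ sort As ∷ʳ A
  sortInit-∷ʳ As A = cong₂ (λ Bs B → sort Bs ∷ʳ B) (init-∷ʳ A As) (last-∷ʳ A As)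
  fuse :
    maybe′ (just ∘ (sort Zs ∷ʳ_)) (Maybe.map (_∷ʳ Z) (Maybe.map sort (raise j o Zs))) (lower j (passAll j Zs o) Z)
    ≡ Maybe.map sortInit (maybe′ (just ∘ (Zs ∷ʳ_)) (Maybe.map (_∷ʳ Z) (raise j o Zs)) (lower j (passAll j Zs o) Z))
  fuse with lower j (passAll j Zs o) Z | raise j o Zs
  ... | just A  | _       = cong just (sym (sortInit-∷ʳ Zs A))
  ... | nothing | just As = cong just (sym (sortInit-∷ʳ As Z))
  ... | nothing | nothing = refl

-- `d` is the answer given by the columns already scanned; `scanPair` falls back on it when `raise`
-- finds nothing to move further right. `p` is the absolute position of the moved column and `l` its
-- position among the remaining ones.
data Scanned (j k : ℕ) (d : Maybe ℕ) (Cs : Vec (Vec Bool n) m) :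
  Maybe ℕ → Maybe (Vec (Vec Bool n) m) → Set where
  stuck : Scanned j k d Cs d nothing
  moved : ∀ {p} l → p ≡ k + l → Scanned j k d Cs (just p) (just (updateCol l (moveDown (suc j)) Cs))

scanPair-raise : ∀ j k o d (Cs : Vec (Vec Bool n) m) →
  Scanned j k d Cs (scanPair (suc j) k o d Cs) (raise j o Cs)
scanPair-raise j k o d [] = stuck
scanPair-raise j k o d (C ∷ Cs) with cellAt C j | cellAt C (suc j)
... | true | true with scanPair (suc j) (suc k) o d Cs | raise j o Cs | scanPair-raise j (suc k) o d Cs
...   | _ | _ | stuck = stuck
...   | _ | _ | moved l e = moved (suc l) (trans e (sym (+-suc k l)))
scanPair-raise j k o d (C ∷ Cs) | false | false
  with scanPair (suc j) (suc k) o d Cs | raise j o Cs | scanPair-raise j (suc k) o d Cs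
...   | _ | _ | stuck = stuck
...   | _ | _ | moved l e = moved (suc l) (trans e (sym (+-suc k l)))
scanPair-raise j k o d (C ∷ Cs) | true | false
  with scanPair (suc j) (suc k) (suc o) d Cs | raise j (suc o) Cs | scanPair-raise j (suc k) (suc o) d Cs
...   | _ | _ | stuck = stuck
...   | _ | _ | moved l e = moved (suc l) (trans e (sym (+-suc k l)))
scanPair-raise j k (suc o) d (C ∷ Cs) | false | true
  with scanPair (suc j) (suc k) o d Cs | raise j o Cs | scanPair-raise j (suc k) o d Cs
...   | _ | _ | stuck = stuck
...   | _ | _ | moved l e = moved (suc l) (trans e (sym (+-suc k l)))
scanPair-raise j k zero d (C ∷ Cs) | false | true
  with scanPair (suc j) (suc k) zero (just k) Cs | raise j zero Cs | scanPair-raise j (suc k) zero (just k) Cs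
...   | _ | _ | stuck = moved zero (sym (+-identityʳ k))
...   | _ | _ | moved l e = moved (suc l) (trans e (sym (+-suc k l)))

eD≡raise : ∀ j (D : Diagram m n) → eD (suc j) D ≡ raise j 0 D
eD≡raise j D with scanPair (suc j) 0 0 nothing D | raise j 0 D | scanPair-raise j 0 0 nothing D
... | _ | _ | stuck = refl
... | _ | _ | moved l refl = refl

eD-sort : ∀ i (D : Diagram m n) → 1 ≤ i → i < n → eD i (sort D) ≡ Maybe.map sort (eD i D)
eD-sort (suc j) D _ i<n = begin
  eD (suc j) (sort D)           ≡⟨ eD≡raise j (sort D) ⟩
  raise j 0 (sort D)            ≡⟨ raise-sort j 0 i<n D ⟩
  Maybe.map sort (raise j 0 D)  ≡⟨ cong (Maybe.map sort) (eD≡raise j D) ⟨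
  Maybe.map sort (eD (suc j) D) ∎
  where open ≡-Reasoning

-- Lock tableaux

occ : ℕ → Vec (Maybe ℕ) n → Fin n → ℕ
occ ℓ col s = b2n (isLabel ℓ (lookup col s))

≡ᵇ-refl : ∀ k → (k ≡ᵇ k) ≡ true
≡ᵇ-refl zero = refl
≡ᵇ-refl (suc k) = ≡ᵇ-refl k

occ≥1 : ∀ ℓ (col : Vec (Maybe ℕ) n) s → lookup col s ≡ just ℓ → 1 ≤ occ ℓ col s
occ≥1 ℓ col s e rewrite e | ≡ᵇ-refl ℓ = ≤-refl

occ⇒lookup : ∀ ℓ (col : Vec (Maybe ℕ) n) s → 1 ≤ occ ℓ col s → lookup col s ≡ just ℓ
occ⇒lookup ℓ col s p with lookup col s
... | just k with ℓ ≡ᵇ k in e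
... | true = cong just (sym (≡ᵇ⇒≡ ℓ k (subst Bool.T (sym e) tt)))

countColumn≡total : ∀ ℓ (col : Vec (Maybe ℕ) n) → countColumn ℓ col ≡ total (occ ℓ col)
countColumn≡total ℓ [] = refl
countColumn≡total ℓ (x ∷ col) = cong (b2n (isLabel ℓ x) +_) (countColumn≡total ℓ col)

countAll≡total : ∀ ℓ (cols : Vec (Vec (Maybe ℕ) n) m) →
  countAll ℓ cols ≡ total (λ c → countColumn ℓ (lookup cols c))
countAll≡total ℓ [] = refl
countAll≡total ℓ (col ∷ cols) = cong (countColumn ℓ col +_) (countAll≡total ℓ cols)

support : Vec (Maybe ℕ) n → Vec Bool n
support = Vec.map is-just

countHigh : Vec (Maybe ℕ) n → ℕ → ℕ → ℕ
countHigh {n} col r₀ r = above {n} r₀ (λ k → below r (occ (suc (toℕ k)) col))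

record LockColumn (κ : Vec Bool n) (col : Vec (Maybe ℕ) n) : Set where
  field
    label : ∀ s ℓ → lookup col s ≡ just ℓ → Σ (Fin n) λ k → ℓ ≡ suc (toℕ k) × toℕ s ≤ toℕ k
    count : ∀ k → total (occ (suc (toℕ k)) col) ≡ bits κ k
open LockColumn

-- Iterated over the rows, this bounds the size of `swapˡ C X` by a cut: the cells of `X` from some
-- row up and the cells of `C` below that row. The first alternative cuts at the present row; it
-- arises when no cell of `C` waits there.
size-swapˡ-row : ∀ c x (C X : Vec Bool n) →
  size (swapˡ (c ∷ C) (x ∷ X)) ≤ size (x ∷ X) ⊎ size (swapˡ (c ∷ C) (x ∷ X)) ≤ b2n c + size (swapˡ C X)
size-swapˡ-row c x C X with surplus C X | size-swapˡ C X
size-swapˡ-row false false C X | k | e = inj₂ ≤-refl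
size-swapˡ-row true x C X | k | e with x | k
... | false | _ = inj₂ ≤-refl
... | true | _ = inj₂ ≤-refl
size-swapˡ-row false true C X | zero | e = inj₁ (s≤s (≤-reflexive e))
size-swapˡ-row false true C X | suc k | e = inj₂ ≤-refl

-- If the cut is at row `s`, the bound on `X` leaves an allowance `h s`, and the increments of `h'`
-- below `s` pay for the cells of `C` there.
size-swapˡ-bound : ∀ (C X : Vec Bool n) (h h' : ℕ → ℕ) {β} →
  (∀ r → above r (bits X) + h r ≤ β) → (∀ r → h' r ≤ h r) →
  (∀ i → bits C i + h' (toℕ i) ≤ h' (suc (toℕ i))) → size (swapˡ C X) + h' 0 ≤ β
size-swapˡ-bound [] [] h h' b le _ = ≤-trans (le 0) (b 0)
size-swapˡ-bound (c ∷ C) (x ∷ X) h h' {β} b le st with size-swapˡ-row c x C X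
... | inj₁ p = ≤-trans (+-mono-≤ p (le 0)) (b 0)
... | inj₂ p = begin
  size (swapˡ (c ∷ C) (x ∷ X)) + h' 0 ≤⟨ +-monoˡ-≤ (h' 0) p ⟩
  b2n c + size (swapˡ C X) + h' 0     ≡⟨ cong (_+ h' 0) (+-comm (b2n c) _) ⟩
  size (swapˡ C X) + b2n c + h' 0     ≡⟨ +-assoc (size (swapˡ C X)) (b2n c) (h' 0) ⟩
  size (swapˡ C X) + (b2n c + h' 0)   ≤⟨ +-monoʳ-≤ (size (swapˡ C X)) (st zero) ⟩
  size (swapˡ C X) + h' 1             ≤⟨ size-swapˡ-bound C X (h ∘ suc) (h' ∘ suc) (b ∘ suc) (le ∘ suc) (st ∘ suc) ⟩
  β                               ∎
  where open ≤-Reasoning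

above-swapˡ-bound : ∀ (C X : Vec Bool n) (h h' : ℕ → ℕ) {β} r →
  (∀ s → r ≤ s → above s (bits X) + h s ≤ β) → (∀ s → h' s ≤ h s) →
  (∀ i → r ≤ toℕ i → bits C i + h' (toℕ i) ≤ h' (suc (toℕ i))) →
  above r (bits (swapˡ C X)) + h' r ≤ β
above-swapˡ-bound C X h h' zero b le st = size-swapˡ-bound C X h h' (λ s → b s z≤n) le (λ i → st i z≤n)
above-swapˡ-bound [] [] h h' (suc r) b le st = ≤-trans (le (suc r)) (b (suc r) ≤-refl)
above-swapˡ-bound (c ∷ C) (x ∷ X) h h' (suc r) b le st =
  above-swapˡ-bound C X (h ∘ suc) (h' ∘ suc) r (λ s r≤s → b (suc s) (s≤s r≤s)) (le ∘ suc)
    (λ i r≤i → st (suc i) (s≤s r≤i))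

-- X is a column brought next to col from the right.  The labels ≥ r₀ that col has below row r stay
-- available for the cells that swapˡ adds in the rows from r₀ up to r.
Room : (ℕ → ℕ) → Vec (Maybe ℕ) n → Vec Bool n → Set
Room β col X = ∀ r₀ r → r₀ ≤ r → above r (bits X) + countHigh col r₀ r ≤ β r₀

-- By (L2) a cell in row `i` has a label of index at least `i`, hence at least `r₀`, so this cell is
-- itself counted on the right.
countHigh-step : ∀ {κ : Vec Bool n} {col} → LockColumn κ col → ∀ r₀ i → r₀ ≤ toℕ i →
  bits (support col) i + countHigh col r₀ (toℕ i) ≤ countHigh col r₀ (suc (toℕ i))
countHigh-step {n} {col = col} lc r₀ i r₀≤i = begin
  bits (support col) i + countHigh col r₀ (toℕ i)
    ≤⟨ +-monoˡ-≤ _ bit ⟩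
  above {n} r₀ (λ k → occ (suc (toℕ k)) col i) + countHigh col r₀ (toℕ i)
    ≡⟨ +-comm (above {n} r₀ (λ k → occ (suc (toℕ k)) col i)) _ ⟩
  countHigh col r₀ (toℕ i) + above {n} r₀ (λ k → occ (suc (toℕ k)) col i)
    ≡⟨ above-+ {n} r₀ (λ k → below (toℕ i) (occ (suc (toℕ k)) col)) (λ k → occ (suc (toℕ k)) col i) ⟨
  above {n} r₀ (λ k → below (toℕ i) (occ (suc (toℕ k)) col) + occ (suc (toℕ k)) col i)
    ≡⟨ above-cong {n} r₀ (λ k → below-suc (occ (suc (toℕ k)) col) i) ⟨
  countHigh col r₀ (suc (toℕ i)) ∎
  where
  open ≤-Reasoning
  bit : bits (support col) i ≤ above {n} r₀ (λ k → occ (suc (toℕ k)) col i)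
  bit rewrite lookup-map i is-just col with lookup col i in e
  ... | nothing = z≤n
  ... | just ℓ with label lc i ℓ e
  ... | k , refl , i≤k = ≤-trans (≤-reflexive (cong b2n (sym (≡ᵇ-refl (toℕ k)))))
        (term≤above {n} r₀ (λ k' → b2n (toℕ k' ≡ᵇ toℕ k)) k (≤-trans r₀≤i i≤k))

swapˡ-∅ : (C : Vec Bool n) → swapˡ C (replicate n false) ≡ C
swapˡ-∅ [] = refl
swapˡ-∅ (true ∷ C) = cong (true ∷_) (swapˡ-∅ C)
swapˡ-∅ (false ∷ C) = cong (false ∷_) (swapˡ-∅ C)

above-∅ : ∀ x → above x (bits (replicate n false)) ≡ 0
above-∅ {zero} zero = refl
above-∅ {suc n} zero = above-∅ {n} zero
above-∅ {zero} (suc x) = refl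
above-∅ {suc n} (suc x) = above-∅ {n} x

Room-self : ∀ {κ : Vec Bool n} {col} → LockColumn κ col → Room (λ r → above r (bits κ)) col (support col)
Room-self {n} {κ} {col} lc r₀ r r₀≤r =
  -- Swapping with the empty column changes nothing, so the general bound applies with `X` empty and
  -- all labels from `r₀` up as allowance.
  subst (λ V → above r (bits V) + countHigh col r₀ r ≤ above r₀ (bits κ)) (swapˡ-∅ (support col))
    (above-swapˡ-bound (support col) (replicate n false) (λ _ → above r₀ (bits κ)) (countHigh col r₀) r
      (λ s _ → ≤-reflexive (cong (_+ above r₀ (bits κ)) (above-∅ {n} s)))
      (λ s → above-mono {n} r₀ (λ k → ≤-trans (below≤total s (occ (suc (toℕ k)) col)) (≤-reflexive (count lc k))))
      (λ i r≤i → countHigh-step lc r₀ i (≤-trans r₀≤r r≤i)))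

-- This is (L3) for neighbouring columns in counting form: a label of the left column recurs weakly
-- lower in the right one.
Flow : Vec (Maybe ℕ) n → Vec (Maybe ℕ) n → Set
Flow {n} col col' = ∀ (k : Fin n) x → below x (occ (suc (toℕ k)) col) ≤ below x (occ (suc (toℕ k)) col')

Room-swapˡ : ∀ {κ : Vec Bool n} {β col col'} X → LockColumn κ col →
  Flow col col' → Room β col' X → Room β col (swapˡ (support col) X)
Room-swapˡ {n} {col = col} {col'} X lc fl room r₀ r r₀≤r =
  above-swapˡ-bound (support col) X (countHigh col' r₀) (countHigh col r₀) r
    (λ s r≤s → room r₀ s (≤-trans r₀≤r r≤s))
    (λ s → above-mono {n} r₀ (λ k → fl k s))
    (λ i r≤i → countHigh-step lc r₀ i (≤-trans r₀≤r r≤i))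

module _ (K : ℕ → Vec Bool n) where
  open Contents K

  LockColumns : Vec (Vec (Maybe ℕ) n) m → Set
  LockColumns [] = ⊤
  LockColumns {m = suc m} (col ∷ []) = LockColumn (K m) col
  LockColumns {m = suc m} (col ∷ cols@(col' ∷ _)) = LockColumn (K m) col × Flow col col' × LockColumns cols

  -- The hypothesis on `f` ranges over all `β` because each column starts its journey to the left
  -- with an allowance given by its own label set.
  LockColumns⇒LockBound : ∀ (f : Vec Bool n → Vec Bool n) (cols : Vec (Vec (Maybe ℕ) n) (suc m)) → LockColumns cols →
    (∀ β X → Room β (Vec.head cols) X → ∀ r → above r (bits (f X)) ≤ β r) →
    LockBound f (Vec.map support cols)
  LockColumns⇒LockBound f (col ∷ []) lc b = b _ _ (Room-self lc) , tt
  LockColumns⇒LockBound f (col ∷ cols@(col' ∷ _)) (lc , fl , lcs) b =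
    b _ _ (Room-self lc) ,
    LockColumns⇒LockBound (f ∘ swapˡ (support col)) cols lcs
      (λ β X room → b β (swapˡ (support col) X) (Room-swapˡ {β = β} {col} {col'} X lc fl room))

  lock-bound : (cols : Vec (Vec (Maybe ℕ) n) m) → LockColumns cols → LockBound id (Vec.map support cols)
  lock-bound [] _ = tt
  lock-bound cols@(_ ∷ _) lcs = LockColumns⇒LockBound id cols lcs
    (λ β X room r → ≤-trans (m≤m+n _ _) (room r r ≤-refl))

  labels≤1 : ∀ {m} (x : Maybe ℕ) → total {m} (λ k → b2n (isLabel (suc (toℕ k)) x)) ≤ b2n (is-just x)
  labels≤1 {m} nothing = ≤-reflexive (total-0 {m} (λ _ → refl))
  labels≤1 {m} (just zero) = ≤-trans (≤-reflexive (total-0 {m} (λ _ → refl))) z≤n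
  labels≤1 {m} (just (suc ℓ)) = single {m} ℓ
    where
    single : ∀ {m} ℓ → total {m} (λ k → b2n (toℕ k ≡ᵇ ℓ)) ≤ 1
    single {zero} ℓ = z≤n
    single {suc m} zero = s≤s (≤-reflexive (total-0 {m} (λ _ → refl)))
    single {suc m} (suc ℓ) = single {m} ℓ

  LockColumn-size : ∀ {κ : Vec Bool n} {col} → LockColumn κ col → size (support col) ≡ size κ
  LockColumn-size {κ} {col} lc = ≤-antisym
    (≤-trans (m≤m+n _ _) (Room-self lc 0 0 z≤n)) (begin
    size κ                                            ≡⟨ total-cong (count lc) ⟨
    total {n} (λ k → total (occ (suc (toℕ k)) col))   ≡⟨ total-swap {n} {n} (λ k → occ (suc (toℕ k)) col) ⟩
    total (λ s → total {n} (λ k → occ (suc (toℕ k)) col s)) ≤⟨ total-mono (λ s → labels≤1 {n} (lookup col s)) ⟩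
    total (λ s → b2n (is-just (lookup col s)))
      ≡⟨ total-cong (λ s → cong b2n (sym (lookup-map s is-just col))) ⟩
    size (support col)                                ∎)
    where open ≤-Reasoning

  lock-sizes : (cols : Vec (Vec (Maybe ℕ) n) m) → LockColumns cols → LockSizes (Vec.map support cols)
  lock-sizes [] _ = tt
  lock-sizes (col ∷ []) lc = LockColumn-size lc , tt
  lock-sizes (col ∷ cols@(_ ∷ _)) (lc , _ , lcs) = LockColumn-size lc , lock-sizes cols lcs

  lockColumns : (cols : Vec (Vec (Maybe ℕ) n) m) →
    (∀ c → LockColumn (K (m ∸ suc (toℕ c))) (lookup cols c)) →
    (∀ c c' → toℕ c' ≡ suc (toℕ c) → Flow (lookup cols c) (lookup cols c')) → LockColumns cols
  lockColumns [] _ _ = tt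
  lockColumns (col ∷ []) lc _ = lc zero
  lockColumns (col ∷ cols@(_ ∷ _)) lc fl =
    lc zero , fl zero (suc zero) refl , lockColumns cols (lc ∘ suc) (λ c c' e → fl (suc c) (suc c') (cong suc e))

Increasing : Vec (Maybe ℕ) n → Set
Increasing {n} col = ∀ (r s : Fin n) ℓ m → lookup col r ≡ just ℓ → lookup col s ≡ just m → toℕ s < toℕ r → m < ℓ

Increasing-tail : ∀ {x} {col : Vec (Maybe ℕ) n} → Increasing (x ∷ col) → Increasing col
Increasing-tail i r s ℓ m p q s<r = i (suc r) (suc s) ℓ m p q (s≤s s<r)

-- The lowest cell of an increasing column carries its least label, which the multiset of labels
-- determines; the remaining cells follow by induction.
increasing-unique : ∀ (col col' : Vec (Maybe ℕ) n) → support col ≡ support col' →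
  (∀ ℓ → total (occ ℓ col) ≡ total (occ ℓ col')) → Increasing col → Increasing col' → col ≡ col'
increasing-unique [] [] _ _ _ _ = refl
increasing-unique (nothing ∷ col) (nothing ∷ col') e co i i' =
  cong (nothing ∷_) (increasing-unique col col' (cong Vec.tail e) co (Increasing-tail i) (Increasing-tail i'))
increasing-unique (just ℓ ∷ col) (just ℓ' ∷ col') e co i i' =
  cong₂ _∷_ (cong just ℓ≡ℓ') (increasing-unique col col' (cong Vec.tail e)
    (λ k → +-cancelˡ-≡ (b2n (k ≡ᵇ ℓ)) _ _ (trans (co k) (cong (λ z → b2n (k ≡ᵇ z) + total (occ k col')) (sym ℓ≡ℓ'))))
    (Increasing-tail i) (Increasing-tail i'))
  where
  least : ∀ {n} ℓ ℓ' (col col' : Vec (Maybe ℕ) n) → total (occ ℓ (just ℓ ∷ col)) ≡ total (occ ℓ (just ℓ' ∷ col')) →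
    Increasing (just ℓ' ∷ col') → ℓ' ≤ ℓ
  least ℓ ℓ' col col' e i
    with total⇒∃ (occ ℓ (just ℓ' ∷ col')) (subst (1 ≤_) e (≤-trans (occ≥1 ℓ (just ℓ ∷ col) zero refl) (m≤m+n _ _)))
  ... | zero , p = ≤-reflexive (just-injective (occ⇒lookup ℓ (just ℓ' ∷ col') zero p))
  ... | suc s , p = <⇒≤ (i (suc s) zero ℓ ℓ' (occ⇒lookup ℓ (just ℓ' ∷ col') (suc s) p) refl (s≤s z≤n))
  ℓ≡ℓ' : ℓ ≡ ℓ'
  ℓ≡ℓ' = ≤-antisym (least ℓ' ℓ col' col (sym (co ℓ')) i) (least ℓ ℓ' col col' (co ℓ) i')
increasing-unique (nothing ∷ col) (just _ ∷ col') ()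
increasing-unique (just _ ∷ col) (nothing ∷ col') ()

-- Greedy key labellings

absorb-+ : ∀ u v k → b2n (fst (absorb u v k)) + next (absorb u v k) ≡ k + b2n v
absorb-+ false false k = sym (+-identityʳ k)
absorb-+ true true k = +-comm 1 k
absorb-+ false true k = +-comm 1 k
absorb-+ true false zero = refl
absorb-+ true false (suc k) = sym (+-identityʳ (suc k))

absorb-fst≤ : ∀ u v k → b2n (fst (absorb u v k)) ≤ b2n u
absorb-fst≤ false false k = z≤n
absorb-fst≤ true true k = ≤-refl
absorb-fst≤ false true k = z≤n
absorb-fst≤ true false zero = z≤n
absorb-fst≤ true false (suc k) = ≤-refl

bits-backˡ≤ : ∀ k (U V : Vec Bool n) i → bits (backˡ k U V) i ≤ bits U i
bits-backˡ≤ k (u ∷ U) (v ∷ V) zero = absorb-fst≤ u v k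
bits-backˡ≤ k (u ∷ U) (v ∷ V) (suc i) = bits-backˡ≤ (next (absorb u v k)) U V i

-- A matched cell of `U` below row `y` either lies in row `x` or higher, or its partner is a cell of
-- `V` below row `x` or one of the `k` cells waiting from the start.
below-backˡ-≤ : ∀ k (U V : Vec Bool n) {x y} → x ≤ y →
  below y (bits (backˡ k U V)) + below x (bits U) ≤ k + below x (bits V) + below y (bits U)
below-backˡ-≤ k U V {y = y} z≤n = begin
  below y (bits (backˡ k U V)) + 0    ≡⟨ +-identityʳ _ ⟩
  below y (bits (backˡ k U V))        ≤⟨ below-mono y (bits-backˡ≤ k U V) ⟩
  below y (bits U)                ≤⟨ m≤n+m _ (k + 0) ⟩
  k + 0 + below y (bits U)        ∎
  where open ≤-Reasoning
below-backˡ-≤ k [] [] (s≤s _) = z≤n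
below-backˡ-≤ k (u ∷ U) (v ∷ V) {suc x} {suc y} (s≤s x≤y) = begin
  (b2n o + q) + (b2n u + below x (bits U))       ≡⟨ interchange (b2n o) q (b2n u) _ ⟩
  (b2n o + b2n u) + (q + below x (bits U))       ≤⟨ +-monoʳ-≤ (b2n o + b2n u) (below-backˡ-≤ k' U V x≤y) ⟩
  (b2n o + b2n u) + (k' + below x (bits V) + below y (bits U)) ≡⟨ cong (b2n o + b2n u +_) (+-assoc k' _ _) ⟩
  (b2n o + b2n u) + (k' + (below x (bits V) + below y (bits U))) ≡⟨ interchange (b2n o) (b2n u) k' _ ⟩
  (b2n o + k') + (b2n u + (below x (bits V) + below y (bits U)))
    ≡⟨ cong₂ _+_ (absorb-+ u v k) (x∙yz≈y∙xz (b2n u) (below x (bits V)) _) ⟩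
  (k + b2n v) + (below x (bits V) + (b2n u + below y (bits U))) ≡⟨ +-assoc (k + b2n v) _ _ ⟨
  (k + b2n v) + below x (bits V) + (b2n u + below y (bits U))
    ≡⟨ cong (_+ (b2n u + below y (bits U))) (+-assoc k (b2n v) _) ⟩
  k + (b2n v + below x (bits V)) + (b2n u + below y (bits U)) ∎
  where
  open ≤-Reasoning
  o = fst (absorb u v k)
  k' = next (absorb u v k)
  q = below y (bits (backˡ k' U V))

-- One of the bounds of below-backˡ-≤, or the trivial bound by U, is attained.
below-backˡ-attained : ∀ k (U V : Vec Bool n) y →
  below y (bits U) ≤ below y (bits (backˡ k U V)) ⊎
  ∃ λ x → x ≤ y × k + below x (bits V) + below y (bits U) ≤ below y (bits (backˡ k U V)) + below x (bits U)
below-backˡ-attained k U V zero = inj₁ z≤n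
below-backˡ-attained k [] [] (suc y) = inj₁ z≤n
below-backˡ-attained k (u ∷ U) (v ∷ V) (suc y) with below-backˡ-attained (next (absorb u v k)) U V y
... | inj₂ (x , x≤y , b) = inj₂ (suc x , s≤s x≤y , (begin
  k + (b2n v + below x (bits V)) + (b2n u + below y (bits U))
    ≡⟨ cong (_+ (b2n u + below y (bits U))) (+-assoc k (b2n v) _) ⟨
  (k + b2n v) + below x (bits V) + (b2n u + below y (bits U)) ≡⟨ +-assoc (k + b2n v) _ _ ⟩
  (k + b2n v) + (below x (bits V) + (b2n u + below y (bits U)))
    ≡⟨ cong₂ _+_ (absorb-+ u v k) (x∙yz≈y∙xz (b2n u) (below x (bits V)) _) ⟨
  (b2n o + k') + (b2n u + (below x (bits V) + below y (bits U))) ≡⟨ interchange (b2n o) k' (b2n u) _ ⟩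
  (b2n o + b2n u) + (k' + (below x (bits V) + below y (bits U))) ≡⟨ cong (b2n o + b2n u +_) (+-assoc k' _ _) ⟨
  (b2n o + b2n u) + (k' + below x (bits V) + below y (bits U)) ≤⟨ +-monoʳ-≤ (b2n o + b2n u) b ⟩
  (b2n o + b2n u) + (q + below x (bits U))       ≡⟨ interchange (b2n o) (b2n u) q _ ⟩
  (b2n o + q) + (b2n u + below x (bits U))       ∎))
  where
  open ≤-Reasoning
  o = fst (absorb u v k)
  k' = next (absorb u v k)
  q = below y (bits (backˡ k' U V))
... | inj₁ b = row u v k b
  where
  row : ∀ u v k → below y (bits U) ≤ below y (bits (backˡ (next (absorb u v k)) U V)) →
    let Q₊ = backˡ k (u ∷ U) (v ∷ V) in
    below (suc y) (bits (u ∷ U)) ≤ below (suc y) (bits Q₊) ⊎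
    ∃ λ x → x ≤ suc y × k + below x (bits (v ∷ V)) + below (suc y) (bits (u ∷ U)) ≤
      below (suc y) (bits Q₊) + below x (bits (u ∷ U))
  row false false k b = inj₁ b
  row false true k b = inj₁ b
  row true true k b = inj₁ (s≤s b)
  row true false (suc k) b = inj₁ (s≤s b)
  -- A cell of `U` that finds nothing waiting stays unmatched, and the cut just above its row is
  -- tight.
  row true false zero b = inj₂ (1 , s≤s z≤n , subst (suc (below y (bits U)) ≤_) (+-comm 1 _) (s≤s b))

size-backˡ≤ : ∀ k (U V : Vec Bool n) → size (backˡ k U V) ≤ k + size V
size-backˡ≤ k [] [] = z≤n
size-backˡ≤ k (u ∷ U) (v ∷ V) = begin
  b2n o + size (backˡ k' U V)   ≤⟨ +-monoʳ-≤ (b2n o) (size-backˡ≤ k' U V) ⟩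
  b2n o + (k' + size V)     ≡⟨ +-assoc (b2n o) k' _ ⟨
  (b2n o + k') + size V     ≡⟨ cong (_+ size V) (absorb-+ u v k) ⟩
  (k + b2n v) + size V      ≡⟨ +-assoc k (b2n v) _ ⟩
  k + (b2n v + size V)      ∎
  where
  open ≤-Reasoning
  o = fst (absorb u v k)
  k' = next (absorb u v k)

below-backˡ₀-≤ : ∀ (U V : Vec Bool n) x → below x (bits (backˡ 0 U V)) ≤ below x (bits V)
below-backˡ₀-≤ U V x = +-cancelʳ-≤ (below x (bits U)) _ _ (below-backˡ-≤ 0 U V {x} {x} ≤-refl)

add : Maybe (Fin n) → Vec ℕ n → Vec ℕ n
add nothing P = P
add (just zero) (p ∷ P) = suc p ∷ P
add (just (suc k)) (p ∷ P) = p ∷ add (just k) P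

takeLeast : Vec ℕ n → Maybe (Fin n) × Vec ℕ n
takeLeast [] = nothing , []
takeLeast (suc p ∷ P) = just zero , p ∷ P
takeLeast (zero ∷ P) = let (g , P') = takeLeast P in Maybe.map suc g , zero ∷ P'

serve : Bool → Vec ℕ n → Maybe (Fin n) × Vec ℕ n
serve false P = nothing , P
serve true P = takeLeast P

-- ls labels the column on the right and P counts the labels that are available from the bottom row on;
-- a label of ls becomes available in its row, which gives (K3), and taking the least one gives (K4).
greedy : Vec ℕ n → Vec Bool m → Vec (Maybe (Fin n)) m → Vec (Maybe (Fin n)) m
greedy P [] [] = []
greedy P (u ∷ U) (l ∷ ls) = let (g , P') = serve u (add l P) in g ∷ greedy P' U ls

under : ℕ → Maybe (Fin n) → Bool
under y nothing = false
under y (just k) = toℕ k <ᵇ y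

Under : ℕ → Vec (Maybe (Fin n)) m → Vec Bool m
Under y = Vec.map (under y)

pending : ℕ → Vec ℕ n → ℕ
pending y P = below y (lookup P)

pending-add : ∀ y l (P : Vec ℕ n) → pending y (add l P) ≡ b2n (under y l) + pending y P
pending-add y nothing P = refl
pending-add zero (just k) P = refl
pending-add (suc y) (just zero) (p ∷ P) = refl
pending-add (suc y) (just (suc k)) (p ∷ P) =
  trans (cong (p +_) (pending-add y (just k) P)) (x∙yz≈y∙xz p (b2n (toℕ k <ᵇ y)) _)

under-map-suc : ∀ y (g : Maybe (Fin n)) → under (suc y) (Maybe.map suc g) ≡ under y g
under-map-suc y nothing = refl
under-map-suc y (just k) = refl

-- Because the least available label is taken, it is below `y` precisely when some available label
-- is. This is the matching rule of `absorb`, at every threshold `y` simultaneously.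
takeLeast-absorb : ∀ y (P : Vec ℕ n) → let (g , P') = takeLeast P in
  absorb true false (pending y P) ≡ (pending y P' , under y g , not (under y g))
takeLeast-absorb zero P with proj₁ (takeLeast P)
... | nothing = refl
... | just _ = refl
takeLeast-absorb (suc y) [] = refl
takeLeast-absorb (suc y) (suc p ∷ P) = refl
takeLeast-absorb (suc y) (zero ∷ P) rewrite under-map-suc y (proj₁ (takeLeast P)) = takeLeast-absorb y P

serve-absorb : ∀ y u l (P : Vec ℕ n) → let (g , P') = serve u (add l P) in
  fst (absorb u (under y l) (pending y P)) ≡ under y g ×
  next (absorb u (under y l) (pending y P)) ≡ pending y P'
serve-absorb y u l P with under y l | pending-add y l P
serve-absorb y false l P | true | e = refl , sym e
serve-absorb y false l P | false | e = refl , sym e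
serve-absorb y true l P | v | e with takeLeast-absorb y (add l P)
serve-absorb y true l P | true | e | a rewrite e = cong fst a , cong next a
serve-absorb y true l P | false | e | a rewrite e = cong fst a , cong next a

-- Recording only which labels are below `y` turns the labelling into the matching `backˡ`. All
-- counts of labels in the greedy columns are read off from these 0/1 shadows.
Under-greedy : ∀ y (P : Vec ℕ n) (U : Vec Bool m) ls → Under y (greedy P U ls) ≡ backˡ (pending y P) U (Under y ls)
Under-greedy y P [] [] = refl
Under-greedy y P (u ∷ U) (l ∷ ls) with serve u (add l P) | serve-absorb y u l P
... | g , P' | e , e' rewrite e | e' = cong (under y g ∷_) (Under-greedy y P' U ls)

lookup-add : ∀ (l : Maybe (Fin n)) P k → lookup (add l P) k ≡ lookup P k ⊎ l ≡ just k
lookup-add nothing P k = inj₁ refl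
lookup-add (just zero) (p ∷ P) zero = inj₂ refl
lookup-add (just zero) (p ∷ P) (suc k) = inj₁ refl
lookup-add (just (suc l)) (p ∷ P) zero = inj₁ refl
lookup-add (just (suc l)) (p ∷ P) (suc k) with lookup-add (just l) P k
... | inj₁ e = inj₁ e
... | inj₂ refl = inj₂ refl

takeLeast-≤ : ∀ (P : Vec ℕ n) k → lookup (proj₂ (takeLeast P)) k ≤ lookup P k
takeLeast-≤ (suc p ∷ P) zero = n≤1+n p
takeLeast-≤ (suc p ∷ P) (suc k) = ≤-refl
takeLeast-≤ (zero ∷ P) zero = ≤-refl
takeLeast-≤ (zero ∷ P) (suc k) = takeLeast-≤ P k

takeLeast-least : ∀ (P : Vec ℕ n) i j → proj₁ (takeLeast P) ≡ just j → toℕ i < toℕ j → lookup P i ≡ 0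
takeLeast-least (suc p ∷ P) i zero e ()
takeLeast-least (zero ∷ P) zero j e _ = refl
takeLeast-least (zero ∷ P) (suc i) j e i<j with proj₁ (takeLeast P) in e'
takeLeast-least (zero ∷ P) (suc i) .(suc j) refl (s≤s i<j) | just j = takeLeast-least P i j e' i<j

takeLeast-available : ∀ (P : Vec ℕ n) k → proj₁ (takeLeast P) ≡ just k → 1 ≤ lookup P k
takeLeast-available (suc p ∷ P) zero e = s≤s z≤n
takeLeast-available (zero ∷ P) k e with proj₁ (takeLeast P) in e'
takeLeast-available (zero ∷ P) .(suc k) refl | just k = takeLeast-available P k e'

serve-≤ : ∀ u (P : Vec ℕ n) k → lookup (proj₂ (serve u P)) k ≤ lookup P k
serve-≤ false P k = ≤-refl
serve-≤ true P k = takeLeast-≤ P k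

greedy-source : ∀ (P : Vec ℕ n) (U : Vec Bool m) ls k s → lookup P k ≡ 0 →
  lookup (greedy P U ls) s ≡ just k → ∃ λ t → toℕ t ≤ toℕ s × lookup ls t ≡ just k
greedy-source P (u ∷ U) (l ∷ ls) k s e p with lookup-add l P k
... | inj₂ l≡k = zero , z≤n , l≡k
greedy-source P (true ∷ U) (l ∷ ls) k zero e p | inj₁ e' =
  ⊥-elim (1+n≢0 (n≤0⇒n≡0 (subst (1 ≤_) (trans e' e) (takeLeast-available (add l P) k p))))
greedy-source P (u ∷ U) (l ∷ ls) k (suc s) e p | inj₁ e'
  with greedy-source (proj₂ (serve u (add l P))) U ls k s
         (n≤0⇒n≡0 (≤-trans (serve-≤ u (add l P) k) (≤-reflexive (trans e' e)))) p
... | t , t≤s , q = suc t , s≤s t≤s , q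

-- If `j` was chosen in row `s` although `i < j`, no `i` was available there. The `i` used higher up
-- therefore entered from the column on the right, strictly above row `s`.
greedy-inversion : ∀ (P : Vec ℕ n) (U : Vec Bool m) ls i j r s → toℕ i < toℕ j → toℕ s < toℕ r →
  lookup (greedy P U ls) r ≡ just i → lookup (greedy P U ls) s ≡ just j →
  ∃ λ t → toℕ s < toℕ t × lookup ls t ≡ just i
greedy-inversion P (true ∷ U) (l ∷ ls) i j (suc r) zero i<j _ p q
  with greedy-source (proj₂ (takeLeast (add l P))) U ls i r
         (n≤0⇒n≡0 (≤-trans (takeLeast-≤ (add l P) i) (≤-reflexive (takeLeast-least (add l P) i j q i<j)))) p
... | t , _ , e = suc t , s≤s z≤n , e
greedy-inversion P (u ∷ U) (l ∷ ls) i j (suc r) (suc s) i<j (s≤s s<r) p q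
  with greedy-inversion (proj₂ (serve u (add l P))) U ls i j r s i<j s<r p q
... | t , s<t , e = suc t , s≤s s<t , e

bits-injective : ∀ (U V : Vec Bool n) → (∀ i → bits U i ≡ bits V i) → U ≡ V
bits-injective [] [] e = refl
bits-injective (u ∷ U) (v ∷ V) e = cong₂ _∷_ (b2n-injective u v (e zero)) (bits-injective U V (e ∘ suc))
  where
  b2n-injective : ∀ u v → b2n u ≡ b2n v → u ≡ v
  b2n-injective true true _ = refl
  b2n-injective false false _ = refl

<ᵇ-suc : ∀ a b → b2n (a <ᵇ suc b) ≡ b2n (a <ᵇ b) + b2n (b ≡ᵇ a)
<ᵇ-suc zero zero = refl
<ᵇ-suc zero (suc b) = refl
<ᵇ-suc (suc a) zero = refl
<ᵇ-suc (suc a) (suc b) = <ᵇ-suc a b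

b2n≤1 : ∀ b → b2n b ≤ 1
b2n≤1 true = ≤-refl
b2n≤1 false = z≤n

toLabels : Vec (Maybe (Fin n)) m → Vec (Maybe ℕ) m
toLabels = Vec.map (Maybe.map (suc ∘ toℕ))

lookup-toLabels : ∀ (col : Vec (Maybe (Fin n)) m) s {k} → lookup col s ≡ just k →
  lookup (toLabels col) s ≡ just (suc (toℕ k))
lookup-toLabels col s e = trans (lookup-map s _ col) (cong (Maybe.map (suc ∘ toℕ)) e)

under-suc : ∀ k (l : Maybe (Fin n)) →
  b2n (under (suc k) l) ≡ b2n (under k l) + b2n (isLabel (suc k) (Maybe.map (suc ∘ toℕ) l))
under-suc k nothing = refl
under-suc k (just l) = <ᵇ-suc (toℕ l) k

size-Under-suc : ∀ k (col : Vec (Maybe (Fin n)) m) →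
  size (Under (suc k) col) ≡ size (Under k col) + total (occ (suc k) (toLabels col))
size-Under-suc k [] = refl
size-Under-suc k (l ∷ col) = trans (cong₂ _+_ (under-suc k l) (size-Under-suc k col))
  (interchange (b2n (under k l)) _ (size (Under k col)) _)

under-n : ∀ (l : Maybe (Fin n)) → under n l ≡ is-just l
under-n nothing = refl
under-n (just k) = Equivalence.to T-≡ (<⇒<ᵇ (toℕ<n k))

-- Key conditions for the greedy labelling

module Key (K : ℕ → Vec Bool n) (K-anti : ∀ c i → bits (K (suc c)) i ≤ bits (K c) i) where
  open Contents K

  Column : Set
  Column = Vec (Maybe (Fin n)) n

  -- These labels have no copy in the next column, so (K3) imposes nothing on them here and they are
  -- available from the bottom row on.
  fresh : ℕ → Vec ℕ n
  fresh c = tabulate (λ i → bits (K c) i ∸ bits (K (suc c)) i)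

  front : Vec Column m → Column
  front [] = replicate n nothing
  front (col ∷ _) = col

  labelling : ℕ → Vec (Vec Bool n) m → Vec Column m
  labelling c [] = []
  labelling c (V ∷ Vs) = greedy (fresh c) V (front (labelling (suc c) Vs)) ∷ labelling (suc c) Vs

  ν : ℕ → ℕ → ℕ
  ν y c = below y (bits (K c))

  ν-split : ∀ y c → pending y (fresh c) + ν y (suc c) ≡ ν y c
  ν-split y c = trans (sym (below-+ y (lookup (fresh c)) (bits (K (suc c)))))
    (below-cong y (λ i → trans (cong (_+ bits (K (suc c)) i) (lookup∘tabulate _ i)) (m∸n+n≡m (K-anti c i))))

  KeyBound-tail : ∀ V f c (Vs : Vec (Vec Bool n) m) → KeyBound (backˡ 0 V ∘ f) c Vs → KeyBound f c Vs
  KeyBound-tail V f c [] _ = tt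
  KeyBound-tail V f c (W ∷ Vs) (b , bs) =
    (λ x → ≤-trans (b x) (below-backˡ₀-≤ V (f W) x)) , KeyBound-tail V (f ∘ backˡ 0 W) (suc c) Vs bs

  -- Sufficient for at least z labels < y to lie in rows < x of the greedily labelled column c₀.
  Reach : ℕ → ℕ → ℕ → ℕ → (Vec Bool n → Vec Bool n) → ℕ → Vec (Vec Bool n) m → Set
  Reach y x z c₀ f c [] = ⊤
  Reach y x z c₀ f c (V ∷ Vs) =
    z + ν y c ≤ ν y c₀ + below x (bits (f V)) × Reach y x z c₀ (f ∘ backˡ 0 V) (suc c) Vs

  -- The choice `x = y` with the full count `ν y c₀` asks that all labels below `y` lie in rows
  -- below `y`; over all `y` this is (K2).
  KeyBound⇒Reach : ∀ y c₀ f c (Vs : Vec (Vec Bool n) m) → KeyBound f c Vs → Reach y y (ν y c₀) c₀ f c Vs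
  KeyBound⇒Reach y c₀ f c [] _ = tt
  KeyBound⇒Reach y c₀ f c (V ∷ Vs) (b , bs) =
    +-monoʳ-≤ (ν y c₀) (b y) , KeyBound⇒Reach y c₀ (f ∘ backˡ 0 V) (suc c) Vs bs

  -- The leftmost column is removed: its fresh labels below `y` and its `w` cells in the rows from
  -- `x'` up to `x` account for part of the demand, and the next column has to meet the remaining
  -- demand `z` below row `x'`.
  Reach-step : ∀ y {x x'} z w V c₀ f c (Vs : Vec (Vec Bool n) m) → x' ≤ x →
    below x (bits V) ≡ below x' (bits V) + w →
    Reach y x (pending y (fresh c₀) + w + z) c₀ (backˡ 0 V ∘ f) c Vs → Reach y x' z (suc c₀) f c Vs
  Reach-step y z w V c₀ f c [] _ _ _ = tt
  Reach-step y {x} {x'} z w V c₀ f c (W ∷ Vs) x'≤x e (b , bs) =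
    +-cancelˡ-≤ (d + w) _ _ bound , Reach-step y z w V c₀ (f ∘ backˡ 0 W) (suc c) Vs x'≤x e bs
    where
    d = pending y (fresh c₀)
    q≤ : below x (bits (backˡ 0 V (f W))) ≤ w + below x' (bits (f W))
    q≤ = +-cancelʳ-≤ (below x' (bits V)) _ _ (begin
      below x (bits (backˡ 0 V (f W))) + below x' (bits V) ≤⟨ below-backˡ-≤ 0 V (f W) x'≤x ⟩
      below x' (bits (f W)) + below x (bits V)         ≡⟨ cong (below x' (bits (f W)) +_) (trans e (+-comm _ w)) ⟩
      below x' (bits (f W)) + (w + below x' (bits V))  ≡⟨ +-assoc (below x' (bits (f W))) w _ ⟨
      below x' (bits (f W)) + w + below x' (bits V)    ≡⟨ cong (_+ below x' (bits V)) (+-comm _ w) ⟩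
      w + below x' (bits (f W)) + below x' (bits V)    ∎)
      where open ≤-Reasoning
    bound : (d + w) + (z + ν y c) ≤ (d + w) + (ν y (suc c₀) + below x' (bits (f W)))
    bound = begin
      (d + w) + (z + ν y c)                             ≡⟨ +-assoc (d + w) z _ ⟨
      d + w + z + ν y c                                 ≤⟨ b ⟩
      ν y c₀ + below x (bits (backˡ 0 V (f W)))             ≤⟨ +-monoʳ-≤ (ν y c₀) q≤ ⟩
      ν y c₀ + (w + below x' (bits (f W)))              ≡⟨ cong (_+ (w + below x' (bits (f W)))) (ν-split y c₀) ⟨
      (d + ν y (suc c₀)) + (w + below x' (bits (f W)))  ≡⟨ interchange d _ w _ ⟩
      (d + w) + (ν y (suc c₀) + below x' (bits (f W)))  ∎
      where open ≤-Reasoning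

  -- The matching attains one of its cut bounds. If `V` itself is the bottleneck, the first
  -- inequality of `Reach` suffices; otherwise the cut row `x'` passes the unmet demand to the next
  -- column. The assumption `z ≤ ν y c` makes the demand vanish once the columns are exhausted.
  front-reach : ∀ y x z c (Vs : Vec (Vec Bool n) m) → ν y (m + c) ≡ 0 → z ≤ ν y c →
    Reach y x z c id c Vs → z ≤ below x (bits (Under y (front (labelling c Vs))))
  front-reach y x z c [] e z≤ _ = ≤-trans z≤ (≤-trans (≤-reflexive e) z≤n)
  front-reach {m = suc m} y x z c (V ∷ Vs) end z≤ (b , bs)
    rewrite Under-greedy y (fresh c) V (front (labelling (suc c) Vs))
    with below-backˡ-attained (pending y (fresh c)) V (Under y (front (labelling (suc c) Vs))) x
  ... | inj₁ p = ≤-trans (+-cancelʳ-≤ (ν y c) _ _ (≤-trans b (≤-reflexive (+-comm (ν y c) _)))) p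
  ... | inj₂ (x' , x'≤x , p) with m≤n⇒∃[o]m+o≡n (below-monoˡ x'≤x)
  ... | w , e = conclude (≤-total (d + w) z)
    where
    d = pending y (fresh c)
    W = Under y (front (labelling (suc c) Vs))
    q = below x (bits (backˡ d V W))
    p' : d + w + below x' (bits W) ≤ q
    p' = +-cancelʳ-≤ (below x' (bits V)) _ _ (begin
      d + w + below x' (bits W) + below x' (bits V)   ≡⟨ cong (_+ below x' (bits V)) (+-assoc d w _) ⟩
      d + (w + below x' (bits W)) + below x' (bits V) ≡⟨ cong (λ v → d + v + below x' (bits V)) (+-comm w _) ⟩
      d + (below x' (bits W) + w) + below x' (bits V) ≡⟨ cong (_+ below x' (bits V)) (+-assoc d _ w) ⟨
      d + below x' (bits W) + w + below x' (bits V)   ≡⟨ +-assoc (d + below x' (bits W)) w _ ⟩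
      d + below x' (bits W) + (w + below x' (bits V)) ≡⟨ cong (d + below x' (bits W) +_) (trans (+-comm w _) e) ⟩
      d + below x' (bits W) + below x (bits V)        ≤⟨ p ⟩
      q + below x' (bits V)                           ∎)
      where open ≤-Reasoning
    conclude : d + w ≤ z ⊎ z ≤ d + w → z ≤ q
    conclude (inj₂ z≤dw) = ≤-trans z≤dw (≤-trans (m≤m+n _ _) p')
    conclude (inj₁ dw≤z) with m≤n⇒∃[o]m+o≡n dw≤z
    ... | z' , refl = ≤-trans (+-monoʳ-≤ (d + w)
            (front-reach y x' z' (suc c) Vs (trans (cong (ν y) (+-suc m c)) end) z'≤
              (Reach-step y z' w V c id (suc c) Vs x'≤x (sym e) bs))) p'
      where
      z'≤ : z' ≤ ν y (suc c)
      z'≤ = m+n≤o⇒n≤o w (+-cancelˡ-≤ d _ _ (begin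
        d + (w + z')      ≡⟨ +-assoc d w z' ⟨
        d + w + z'        ≤⟨ z≤ ⟩
        ν y c             ≡⟨ ν-split y c ⟨
        d + ν y (suc c)   ∎))
        where open ≤-Reasoning

  front-size≤ : ∀ y c (Vs : Vec (Vec Bool n) m) → size (Under y (front (labelling c Vs))) ≤ ν y c
  front-size≤ y c [] = ≤-trans (≤-reflexive (total-0 none)) z≤n
    where
    none : ∀ i → bits (Under y (front [])) i ≡ 0
    none i = cong b2n (trans (lookup-map i (under y) (front [])) (cong (under y) (lookup-replicate i nothing)))
  front-size≤ y c (V ∷ Vs) = begin
    size (Under y (greedy (fresh c) V (front (labelling (suc c) Vs))))
      ≡⟨ cong size (Under-greedy y (fresh c) V _) ⟩
    size (backˡ (pending y (fresh c)) V (Under y (front (labelling (suc c) Vs))))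
      ≤⟨ size-backˡ≤ (pending y (fresh c)) V _ ⟩
    pending y (fresh c) + size (Under y (front (labelling (suc c) Vs)))
      ≤⟨ +-monoʳ-≤ _ (front-size≤ y (suc c) Vs) ⟩
    pending y (fresh c) + ν y (suc c)                                      ≡⟨ ν-split y c ⟩
    ν y c                                                                  ∎
    where open ≤-Reasoning

  Valid : ℕ → Vec (Vec Bool n) m → Set
  Valid {m} c Vs = KeyBound id c Vs × KeySizes c Vs × (∀ i → bits (K (m + c)) i ≡ 0)

  ν-0 : ∀ y c → (∀ i → bits (K c) i ≡ 0) → ν y c ≡ 0
  ν-0 y c e = n≤0⇒n≡0 (≤-trans (below≤total y (bits (K c))) (≤-reflexive (total-0 e)))

  ν≤front : ∀ y c (Vs : Vec (Vec Bool n) m) → Valid c Vs → ν y c ≤ below y (bits (Under y (front (labelling c Vs))))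
  ν≤front {m} y c Vs (b , _ , e) =
    front-reach y y (ν y c) c Vs (ν-0 y (m + c) e) ≤-refl (KeyBound⇒Reach y c id c Vs b)

  front-size : ∀ y c (Vs : Vec (Vec Bool n) m) → Valid c Vs → size (Under y (front (labelling c Vs))) ≡ ν y c
  front-size y c Vs v = ≤-antisym (front-size≤ y c Vs) (≤-trans (ν≤front y c Vs v) (below≤total y _))

  Valid-tail : ∀ c V (Vs : Vec (Vec Bool n) m) → Valid c (V ∷ Vs) → Valid (suc c) Vs
  Valid-tail {m} c V Vs ((_ , bs) , (_ , ss) , e) =
    KeyBound-tail V id (suc c) Vs bs , ss , subst (λ k → ∀ i → bits (K k) i ≡ 0) (sym (+-suc m c)) e

  front-count : ∀ c (Vs : Vec (Vec Bool n) m) → Valid c Vs → ∀ k →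
    total (occ (suc (toℕ k)) (toLabels (front (labelling c Vs)))) ≡ bits (K c) k
  front-count c Vs v k = +-cancelˡ-≡ (ν (toℕ k) c) _ _ (begin
    ν (toℕ k) c + total (occ (suc (toℕ k)) (toLabels col))
      ≡⟨ cong (_+ total (occ (suc (toℕ k)) (toLabels col))) (front-size (toℕ k) c Vs v) ⟨
    size (Under (toℕ k) col) + total (occ (suc (toℕ k)) (toLabels col))
      ≡⟨ size-Under-suc (toℕ k) col ⟨
    size (Under (suc (toℕ k)) col)
      ≡⟨ front-size (suc (toℕ k)) c Vs v ⟩
    ν (suc (toℕ k)) c
      ≡⟨ below-suc (bits (K c)) k ⟩
    ν (toℕ k) c + bits (K c) k ∎)
    where
    open ≡-Reasoning
    col = front (labelling c Vs)

  front-row : ∀ c (Vs : Vec (Vec Bool n) m) → Valid c Vs → ∀ s k →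
    lookup (front (labelling c Vs)) s ≡ just k → toℕ s ≤ toℕ k
  front-row c Vs v s k e = ≮⇒≥ λ k<s → 1+n≰n (begin
    1                    ≡⟨ cong b2n (sym bit) ⟩
    bits col s           ≤⟨ term≤above y (bits col) s k<s ⟩
    above y (bits col)   ≤⟨ +-cancelˡ-≤ (below y (bits col)) _ _ (begin
      below y (bits col) + above y (bits col) ≡⟨ below+above y (bits col) ⟩
      size col                                ≡⟨ front-size y c Vs v ⟩
      ν y c                                   ≤⟨ ν≤front y c Vs v ⟩
      below y (bits col)                      ≡⟨ +-identityʳ _ ⟨
      below y (bits col) + 0                  ∎) ⟩
    0                    ∎)
    where
    open ≤-Reasoning
    y = suc (toℕ k)
    col = Under y (front (labelling c Vs))
    bit : lookup col s ≡ true
    bit = trans (lookup-map s (under y) (front (labelling c Vs)))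
      (trans (cong (under y) e) (Equivalence.to T-≡ (<⇒<ᵇ (n<1+n (toℕ k)))))

  -- Labels are placed on cells of `V` only, and there are as many labels as cells, so no cell stays
  -- unlabelled.
  front-support : ∀ c V (Vs : Vec (Vec Bool n) m) → Valid c (V ∷ Vs) →
    Vec.map is-just (front (labelling c (V ∷ Vs))) ≡ V
  front-support c V Vs v@(_ , (s , _) , _) = trans (sym (map-cong under-n col))
    (sym (bits-injective V (Under n col) (total-squeeze
      (λ i → ≤-trans (≤-reflexive (cong (λ W → bits W i) (Under-greedy n (fresh c) V _))) (bits-backˡ≤ _ V _ i))
      (begin
        size V             ≡⟨ s ⟩
        size (K c)         ≡⟨ below-n (bits (K c)) ⟨
        ν n c              ≡⟨ front-size n c (V ∷ Vs) v ⟨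
        size (Under n col) ∎))))
    where
    open ≡-Reasoning
    col = front (labelling c (V ∷ Vs))

  labelling-support : ∀ c (Vs : Vec (Vec Bool n) m) → Valid c Vs → Vec.map (Vec.map is-just) (labelling c Vs) ≡ Vs
  labelling-support c [] _ = refl
  labelling-support c (V ∷ Vs) v =
    cong₂ _∷_ (front-support c V Vs v) (labelling-support (suc c) Vs (Valid-tail c V Vs v))

  labelling-count : ∀ c (Vs : Vec (Vec Bool n) m) → Valid c Vs → ∀ i k →
    total (occ (suc (toℕ k)) (toLabels (lookup (labelling c Vs) i))) ≡ bits (K (toℕ i + c)) k
  labelling-count c (V ∷ Vs) v zero k = front-count c (V ∷ Vs) v k
  labelling-count c (V ∷ Vs) v (suc i) k = trans (labelling-count (suc c) Vs (Valid-tail c V Vs v) i k)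
    (cong (λ c' → bits (K c') k) (+-suc (toℕ i) c))

  labelling-row : ∀ c (Vs : Vec (Vec Bool n) m) → Valid c Vs → ∀ i s k →
    lookup (lookup (labelling c Vs) i) s ≡ just k → toℕ s ≤ toℕ k
  labelling-row c (V ∷ Vs) v zero s k e = front-row c (V ∷ Vs) v s k e
  labelling-row c (V ∷ Vs) v (suc i) s k e = labelling-row (suc c) Vs (Valid-tail c V Vs v) i s k e

  K-anti-+ : ∀ d c i → bits (K (d + c)) i ≤ bits (K c) i
  K-anti-+ zero c i = ≤-refl
  K-anti-+ (suc d) c i = ≤-trans (K-anti (d + c) i) (K-anti-+ d c i)

  labelling-old : ∀ c (Vs : Vec (Vec Bool n) m) → Valid c Vs → ∀ i t k →
    lookup (lookup (labelling c Vs) i) t ≡ just k → 1 ≤ bits (K c) k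
  labelling-old c Vs v i t k e = ≤-trans (occ≥1 (suc (toℕ k)) (toLabels col) t (lookup-toLabels col t e))
    (≤-trans (term≤total (occ (suc (toℕ k)) (toLabels col)) t)
      (≤-trans (≤-reflexive (labelling-count c Vs v i k)) (K-anti-+ (toℕ i) c k)))
    where col = lookup (labelling c Vs) i

  fresh-old : ∀ c k → 1 ≤ bits (K (suc c)) k → lookup (fresh c) k ≡ 0
  fresh-old c k p = trans (lookup∘tabulate _ k) (m≤n⇒m∸n≡0 (≤-trans (b2n≤1 (lookup (K c) k)) p))

  -- A label that occurs further right is not fresh, so it came from a weakly lower row of the next
  -- column, where it occurs only once.
  labelling-descends : ∀ c (Vs : Vec (Vec Bool n) m) → Valid c Vs → ∀ i j s t k → toℕ i < toℕ j →
    lookup (lookup (labelling c Vs) i) s ≡ just k → lookup (lookup (labelling c Vs) j) t ≡ just k → toℕ t ≤ toℕ s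
  labelling-descends c (V ∷ Vs) v (suc i) (suc j) s t k (s≤s i<j) p q =
    labelling-descends (suc c) Vs (Valid-tail c V Vs v) i j s t k i<j p q
  labelling-descends c (V ∷ W ∷ Vs) v zero (suc j) s t k _ p q
    with greedy-source (fresh c) V (front (labelling (suc c) (W ∷ Vs))) k s
           (fresh-old c k (labelling-old (suc c) (W ∷ Vs) (Valid-tail c V _ v) j t k q)) p
  labelling-descends c (V ∷ W ∷ Vs) v zero (suc (suc j)) s t k _ p q | t₀ , t₀≤s , e =
    ≤-trans (labelling-descends (suc c) (W ∷ Vs) (Valid-tail c V _ v) zero (suc j) t₀ t k (s≤s z≤n) e q) t₀≤s
  labelling-descends c (V ∷ W ∷ Vs) v zero (suc zero) s t k _ p q | t₀ , t₀≤s , e =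
    subst (λ t → toℕ t ≤ toℕ s) (total-unique (occ (suc (toℕ k)) (toLabels col)) t₀ t
      (≤-trans (≤-reflexive (front-count (suc c) (W ∷ Vs) (Valid-tail c V _ v) k)) (b2n≤1 (lookup (K (suc c)) k)))
      (occ≥1 _ (toLabels col) t₀ (lookup-toLabels col t₀ e))
      (occ≥1 _ (toLabels col) t (lookup-toLabels col t q))) t₀≤s
    where col = front (labelling (suc c) (W ∷ Vs))

  labelling-inversion : ∀ c (Vs : Vec (Vec Bool n) m) i r s a b → toℕ a < toℕ b → toℕ s < toℕ r →
    lookup (lookup (labelling c Vs) i) r ≡ just a → lookup (lookup (labelling c Vs) i) s ≡ just b →
    ∃ λ i' → ∃ λ t → toℕ i' ≡ suc (toℕ i) × toℕ s < toℕ t × lookup (lookup (labelling c Vs) i') t ≡ just a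
  labelling-inversion c (V ∷ Vs) (suc i) r s a b a<b s<r p q with labelling-inversion (suc c) Vs i r s a b a<b s<r p q
  ... | i' , t , e , s<t , l = suc i' , t , cong suc e , s<t , l
  labelling-inversion c (V ∷ Vs) zero r s a b a<b s<r p q
    with greedy-inversion (fresh c) V (front (labelling (suc c) Vs)) a b r s a<b s<r p q
  labelling-inversion c (V ∷ []) zero r s a b _ _ _ _ | t , _ , l with () ← trans (sym (lookup-replicate t nothing)) l
  labelling-inversion c (V ∷ W ∷ Vs) zero r s a b _ _ _ _ | t , s<t , l = suc zero , t , refl , s<t , l

-- The embedding of lock tableaux into key tableaux

keyColumn : Vec ℕ n → ℕ → Vec Bool n
keyColumn a c = Vec.map (c <ᵇ_) a

bits-keyColumn : ∀ (a : Vec ℕ n) c k → bits (keyColumn a c) k ≡ b2n (c <ᵇ lookup a k)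
bits-keyColumn a c k = cong b2n (lookup-map k (c <ᵇ_) a)

<ᵇ-true : ∀ {c x} → c < x → b2n (c <ᵇ x) ≡ 1
<ᵇ-true c<x = cong b2n (Equivalence.to T-≡ (<⇒<ᵇ c<x))

<ᵇ-false : ∀ {c x} → x ≤ c → b2n (c <ᵇ x) ≡ 0
<ᵇ-false z≤n = refl
<ᵇ-false (s≤s x≤c) = <ᵇ-false x≤c

keyColumn-anti : ∀ (a : Vec ℕ n) c k → bits (keyColumn a (suc c)) k ≤ bits (keyColumn a c) k
keyColumn-anti a c k rewrite bits-keyColumn a (suc c) k | bits-keyColumn a c k = anti c (lookup a k)
  where
  anti : ∀ c x → b2n (suc c <ᵇ x) ≤ b2n (c <ᵇ x)
  anti c zero = z≤n
  anti zero (suc x) = b2n≤1 (0 <ᵇ x)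
  anti (suc c) (suc x) = anti c x

lookup≤maxV : ∀ (a : Vec ℕ n) k → lookup a k ≤ maxV a
lookup≤maxV (x ∷ a) zero = m≤m⊔n x (maxV a)
lookup≤maxV (x ∷ a) (suc k) = ≤-trans (lookup≤maxV a k) (m≤n⊔m x (maxV a))

total-key : ∀ M x → total {M} (λ c → b2n (toℕ c <ᵇ x)) ≡ M ⊓ x
total-key zero x = refl
total-key (suc M) zero = total-0 {M} (λ _ → refl)
total-key (suc M) (suc x) = cong suc (total-key M x)

total-lock : ∀ M x → total {M} (λ c → b2n (M ∸ suc (toℕ c) <ᵇ x)) ≡ M ⊓ x
total-lock zero x = refl
total-lock (suc M) x with x ≤? M
... | yes x≤M = begin
  b2n (M <ᵇ x) + total {M} (λ c → b2n (M ∸ suc (toℕ c) <ᵇ x)) ≡⟨ cong₂ _+_ (<ᵇ-false x≤M) (total-lock M x) ⟩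
  M ⊓ x                                                        ≡⟨ m≥n⇒m⊓n≡n x≤M ⟩
  x                                                            ≡⟨ m≥n⇒m⊓n≡n (m≤n⇒m≤1+n x≤M) ⟨
  suc M ⊓ x                                                    ∎
  where open ≡-Reasoning
... | no x≰M = begin
  b2n (M <ᵇ x) + total {M} (λ c → b2n (M ∸ suc (toℕ c) <ᵇ x)) ≡⟨ cong₂ _+_ (<ᵇ-true (≰⇒> x≰M)) (total-lock M x) ⟩
  suc (M ⊓ x)                                                  ≡⟨ cong suc (m≤n⇒m⊓n≡m (<⇒≤ (≰⇒> x≰M))) ⟩
  suc M                                                        ≡⟨ m≤n⇒m⊓n≡m (≰⇒> x≰M) ⟨
  suc M ⊓ x                                                    ∎
  where open ≡-Reasoning

module _ (a : Vec ℕ n) where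

  private
    M = maxV a
    K = keyColumn a
  open Contents K
  open Key K (keyColumn-anti a)

  -- (L1) bounds the count from below in every column, and the content makes the totals agree, so no
  -- copy is left for any other column.
  lock-count : ∀ T → IsLKT a T → ∀ c k →
    total (occ (suc (toℕ k)) (lookup T c)) ≡ bits (K (M ∸ suc (toℕ c))) k
  lock-count T ((_ , content) , l1 , _) c k = begin
    total (occ (suc (toℕ k)) (lookup T c)) ≡⟨ countColumn≡total (suc (toℕ k)) (lookup T c) ⟨
    countColumn (suc (toℕ k)) (lookup T c) ≡⟨ total-squeeze lower-bound totals c ⟩
    b2n (M ∸ suc (toℕ c) <ᵇ lookup a k)    ≡⟨ bits-keyColumn a (M ∸ suc (toℕ c)) k ⟨
    bits (K (M ∸ suc (toℕ c))) k           ∎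
    where
    open ≡-Reasoning
    totals : total (λ c → countColumn (suc (toℕ k)) (lookup T c)) ≡
      total {M} (λ c → b2n (M ∸ suc (toℕ c) <ᵇ lookup a k))
    totals = begin
      total (λ c → countColumn (suc (toℕ k)) (lookup T c))      ≡⟨ countAll≡total (suc (toℕ k)) T ⟨
      countAll (suc (toℕ k)) T                                  ≡⟨ content k ⟩
      lookup a k                                                ≡⟨ m≥n⇒m⊓n≡n (lookup≤maxV a k) ⟨
      M ⊓ lookup a k                                            ≡⟨ total-lock M (lookup a k) ⟨
      total {M} (λ c → b2n (M ∸ suc (toℕ c) <ᵇ lookup a k))     ∎
    lower-bound : ∀ c → b2n (M ∸ suc (toℕ c) <ᵇ lookup a k) ≤ countColumn (suc (toℕ k)) (lookup T c)
    lower-bound c with (M ∸ suc (toℕ c)) <? lookup a k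
    ... | no ≮ = ≤-trans (≤-reflexive (<ᵇ-false (≮⇒≥ ≮))) z≤n
    ... | yes p = ≤-reflexive (trans (<ᵇ-true p) (sym (l1 k c (m≤n+o⇒m∸n≤o M (lookup a k) (s≤s⁻¹ (≤R.begin
        suc M                                ≤R.≤⟨ s≤s (m≤n+m∸n M (suc (toℕ c))) ⟩
        suc (suc (toℕ c) + (M ∸ suc (toℕ c))) ≤R.≡⟨ +-suc (suc (toℕ c)) _ ⟨
        suc (toℕ c) + suc (M ∸ suc (toℕ c))  ≤R.≤⟨ +-monoʳ-≤ (suc (toℕ c)) p ⟩
        suc (toℕ c) + lookup a k             ≤R.≡⟨ cong suc (+-comm (toℕ c) _) ⟩
        suc (lookup a k + toℕ c)             ≤R.∎))))))
      where module ≤R = ≤-Reasoning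

  lock-column : ∀ T → IsLKT a T → ∀ c → LockColumn (K (M ∸ suc (toℕ c))) (lookup T c)
  lock-column T lkt@((range , _) , _ , row , _) c = record { label = lab ; count = lock-count T lkt c }
    where
    lab : ∀ s ℓ → lookup (lookup T c) s ≡ just ℓ → Σ (Fin n) λ k → ℓ ≡ suc (toℕ k) × toℕ s ≤ toℕ k
    lab s ℓ e with range c s ℓ e | row c s ℓ e
    ... | s≤s {n = ℓ'} _ , ℓ<n | s≤s s≤ℓ' =
      fromℕ< ℓ<n , cong suc (sym (toℕ-fromℕ< ℓ<n)) , subst (toℕ s ≤_) (sym (toℕ-fromℕ< ℓ<n)) s≤ℓ'

  lock-flow : ∀ T → IsLKT a T → ∀ c c' → toℕ c' ≡ suc (toℕ c) → Flow (lookup T c) (lookup T c')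
  lock-flow T lkt@(_ , _ , _ , desc , _) c c' e k x with below x (occ (suc (toℕ k)) (lookup T c)) in eq
  ... | zero = z≤n
  ... | suc b with below⇒∃ x (occ (suc (toℕ k)) (lookup T c)) (subst (1 ≤_) (sym eq) (s≤s z≤n))
  ... | s , s<x , p with total⇒∃ (occ (suc (toℕ k)) (lookup T c')) (begin
      1                                            ≤⟨ p ⟩
      occ (suc (toℕ k)) (lookup T c) s             ≤⟨ term≤total (occ (suc (toℕ k)) (lookup T c)) s ⟩
      total (occ (suc (toℕ k)) (lookup T c))       ≡⟨ lock-count T lkt c k ⟩
      bits (K (M ∸ suc (toℕ c))) k                 ≡⟨ cong (λ d → bits (K d) k) step ⟩
      bits (K (suc (M ∸ suc (toℕ c')))) k          ≤⟨ keyColumn-anti a _ k ⟩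
      bits (K (M ∸ suc (toℕ c'))) k                ≡⟨ lock-count T lkt c' k ⟨
      total (occ (suc (toℕ k)) (lookup T c'))      ∎)
    where
    open ≤-Reasoning
    step : M ∸ suc (toℕ c) ≡ suc (M ∸ suc (toℕ c'))
    step = trans (cong (M ∸_) (sym e)) (+-∸-assoc 1 (toℕ<n c'))
  ... | t , q = begin
    suc b                                            ≡⟨ eq ⟨
    below x (occ (suc (toℕ k)) (lookup T c))         ≤⟨ below≤total x _ ⟩
    total (occ (suc (toℕ k)) (lookup T c))           ≡⟨ lock-count T lkt c k ⟩
    bits (K (M ∸ suc (toℕ c))) k                     ≤⟨ b2n≤1 (lookup (K (M ∸ suc (toℕ c))) k) ⟩
    1                                                ≤⟨ q ⟩
    occ (suc (toℕ k)) (lookup T c') t                ≤⟨ term≤below x _ t (≤-<-trans t≤s s<x) ⟩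
    below x (occ (suc (toℕ k)) (lookup T c'))        ∎
    where
    open ≤-Reasoning
    t≤s : toℕ t ≤ toℕ s
    t≤s = desc c c' s t (suc (toℕ k)) (occ⇒lookup _ (lookup T c) s p) (occ⇒lookup _ (lookup T c') t q)
      (≤-reflexive (sym e))

  lock-columns : ∀ T → IsLKT a T → LockColumns K T
  lock-columns T lkt = lockColumns K T (lock-column T lkt) (lock-flow T lkt)

  lock-allMatched : ∀ T → IsLKT a T → AllMatched (𝔻 T)
  lock-allMatched T lkt = LockBound⇒AllMatched (𝔻 T) (lock-bound K T lcs) (lock-sizes K T lcs)
    where lcs = lock-columns T lkt

  sort-valid : ∀ T → IsLKT a T → Valid 0 (sort (𝔻 T))
  sort-valid T lkt =
    sort-KeyBound (𝔻 T) (lock-bound K T lcs) (lock-sizes K T lcs) am ,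
    sort-KeySizes (𝔻 T) (lock-sizes K T lcs) am ,
    -- Every part is at most `M`, so no label reaches column `M`, the first one beyond the diagram.
    λ k → trans (bits-keyColumn a (M + 0) k)
      (<ᵇ-false (≤-trans (lookup≤maxV a k) (≤-reflexive (sym (+-identityʳ M)))))
    where
    lcs = lock-columns T lkt
    am = lock-allMatched T lkt

  keyLabelling : Diagram M n → LD M n
  keyLabelling D = Vec.map toLabels (labelling 0 D)

  𝔻-keyLabelling : ∀ D → Valid 0 D → 𝔻 (keyLabelling D) ≡ D
  𝔻-keyLabelling D v = trans (sym (map-∘ _ _ (labelling 0 D)))
    (trans (map-cong forget (labelling 0 D)) (labelling-support 0 D v))
    where
    is-just-map : ∀ (l : Maybe (Fin n)) → is-just (Maybe.map (suc ∘ toℕ) l) ≡ is-just l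
    is-just-map nothing = refl
    is-just-map (just _) = refl
    forget : ∀ col → support (toLabels col) ≡ Vec.map is-just col
    forget col = trans (sym (map-∘ _ _ col)) (map-cong is-just-map col)

  unlabel : ∀ D c r ℓ → L (keyLabelling D) c r ≡ just ℓ →
    ∃ λ k → ℓ ≡ suc (toℕ k) × lookup (lookup (labelling 0 D) c) r ≡ just k
  unlabel D c r ℓ e with lookup (lookup (labelling 0 D) c) r
    | trans (sym (trans (cong (λ col → lookup col r) (lookup-map c toLabels (labelling 0 D)))
                        (lookup-map r _ (lookup (labelling 0 D) c)))) e
  ... | just k | e' = k , sym (just-injective e') , refl

  relabel : ∀ D c r {k} → lookup (lookup (labelling 0 D) c) r ≡ just k →
    L (keyLabelling D) c r ≡ just (suc (toℕ k))
  relabel D c r e = trans (cong (λ col → lookup col r) (lookup-map c toLabels (labelling 0 D)))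
    (lookup-toLabels (lookup (labelling 0 D) c) r e)

  keyLabelling-count : ∀ D → Valid 0 D → ∀ c k →
    countColumn (suc (toℕ k)) (lookup (keyLabelling D) c) ≡ b2n (toℕ c <ᵇ lookup a k)
  keyLabelling-count D v c k = begin
    countColumn (suc (toℕ k)) (lookup (keyLabelling D) c)
      ≡⟨ countColumn≡total (suc (toℕ k)) (lookup (keyLabelling D) c) ⟩
    total (occ (suc (toℕ k)) (lookup (keyLabelling D) c))
      ≡⟨ cong (λ col → total (occ (suc (toℕ k)) col)) (lookup-map c toLabels (labelling 0 D)) ⟩
    total (occ (suc (toℕ k)) (toLabels (lookup (labelling 0 D) c)))
      ≡⟨ labelling-count 0 D v c k ⟩
    bits (K (toℕ c + 0)) k
      ≡⟨ cong (λ d → bits (K d) k) (+-identityʳ (toℕ c)) ⟩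
    bits (K (toℕ c)) k
      ≡⟨ bits-keyColumn a (toℕ c) k ⟩
    b2n (toℕ c <ᵇ lookup a k) ∎
    where open ≡-Reasoning

  keyLabelling-IsKKT : ∀ D → Valid 0 D → IsKKT a (keyLabelling D)
  keyLabelling-IsKKT D v = (range , content) , k1 , row , desc , k4
    where
    T' = keyLabelling D
    range : ∀ c r ℓ → L T' c r ≡ just ℓ → 1 ≤ ℓ × ℓ ≤ n
    range c r ℓ e with unlabel D c r ℓ e
    ... | k , refl , _ = s≤s z≤n , toℕ<n k
    content : ∀ k → countAll (suc (toℕ k)) T' ≡ lookup a k
    content k = begin
      countAll (suc (toℕ k)) T'                              ≡⟨ countAll≡total (suc (toℕ k)) T' ⟩
      total (λ c → countColumn (suc (toℕ k)) (lookup T' c))  ≡⟨ total-cong (λ c → keyLabelling-count D v c k) ⟩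
      total {M} (λ c → b2n (toℕ c <ᵇ lookup a k))            ≡⟨ total-key M (lookup a k) ⟩
      M ⊓ lookup a k                                         ≡⟨ m≥n⇒m⊓n≡n (lookup≤maxV a k) ⟩
      lookup a k                                             ∎
      where open ≡-Reasoning
    k1 : K1 a T'
    k1 k c c<a = trans (keyLabelling-count D v c k) (<ᵇ-true c<a)
    row : RowCond T'
    row c r ℓ e with unlabel D c r ℓ e
    ... | k , refl , e' = s≤s (labelling-row 0 D v c r k e')
    desc : DescCond T'
    desc c c' r r' ℓ e e' c<c' with unlabel D c r ℓ e | unlabel D c' r' ℓ e'
    ... | k , refl , p | k' , q , p' with refl ← toℕ-injective (suc-injective q) =
      labelling-descends 0 D v c c' r r' k c<c' p p'
    k4 : K4 T'
    k4 c r s i j e e' i<j s<r with unlabel D c r i e | unlabel D c s j e'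
    ... | x , refl , p | y , refl , q with labelling-inversion 0 D c r s x y (s≤s⁻¹ i<j) s<r p q
    ... | c' , t , f , s<t , l = c' , t , f , s<t , relabel D c' t l

  lock-unique : ∀ T T' → IsLKT a T → IsLKT a T' → 𝔻 T ≡ 𝔻 T' → T ≡ T'
  lock-unique T T' lkt lkt' e = vec-ext T T' λ c →
    increasing-unique (lookup T c) (lookup T' c)
      (trans (sym (lookup-map c support T)) (trans (cong (λ D → lookup D c) e) (lookup-map c support T')))
      (counts c) (proj₂ (proj₂ (proj₂ (proj₂ lkt))) c) (proj₂ (proj₂ (proj₂ (proj₂ lkt'))) c)
    where
    vec-ext : ∀ {A : Set} {m} (xs ys : Vec A m) → (∀ i → lookup xs i ≡ lookup ys i) → xs ≡ ys
    vec-ext xs ys f = trans (sym (tabulate∘lookup xs)) (trans (tabulate-cong f) (tabulate∘lookup ys))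
    -- `lock-count` covers only the labels from 1 to `n`; any other `ℓ` has count zero, since a
    -- label that occurs lies in that range.
    count≤ : ∀ T T' → IsLKT a T → IsLKT a T' → ∀ c ℓ → total (occ ℓ (lookup T c)) ≤ total (occ ℓ (lookup T' c))
    count≤ T T' lkt lkt' c ℓ with total (occ ℓ (lookup T c)) in eq
    ... | zero = z≤n
    ... | suc b with total⇒∃ (occ ℓ (lookup T c)) (subst (1 ≤_) (sym eq) (s≤s z≤n))
    ... | s , p with LockColumn.label (lock-column T lkt c) s ℓ (occ⇒lookup ℓ (lookup T c) s p)
    ... | k , refl , _ = ≤-reflexive (trans (sym eq) (trans (lock-count T lkt c k) (sym (lock-count T' lkt' c k))))
    counts : ∀ c ℓ → total (occ ℓ (lookup T c)) ≡ total (occ ℓ (lookup T' c))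
    counts c ℓ = ≤-antisym (count≤ T T' lkt lkt' c ℓ) (count≤ T' T lkt' lkt c ℓ)

theorem5p1 : ∀ {n} (a : Vec ℕ n) →
    Σ (LKT a → KKT a) λ Φ →
    (∀ T T' → proj₁ (Φ T) ≡ proj₁ (Φ T') → proj₁ T ≡ proj₁ T') ×
    (∀ T → wt (𝔻 (proj₁ (Φ T))) ≡ wt (𝔻 (proj₁ T))) ×
    (∀ (i : ℕ) → 1 ≤ i → i < n → ∀ (T T' : LKT a) →
    LockE a i (proj₁ T) (proj₁ T') → KeyE a i (proj₁ (Φ T)) (proj₁ (Φ T'))) ×
    (∀ (i : ℕ) → 1 ≤ i → i < n → ∀ (T T' : LKT a) →
    LockF a i (proj₁ T) (proj₁ T') → KeyF a i (proj₁ (Φ T)) (proj₁ (Φ T')))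
theorem5p1 {n} a = Φ , injective , weight , raising ,
  λ i 1≤i i<n T T' (lkt' , lockE) → proj₂ (Φ T') , raising i 1≤i i<n T' T lockE
  where
  Φ : LKT a → KKT a
  Φ (T , lkt) = keyLabelling a (sort (𝔻 T)) , keyLabelling-IsKKT a (sort (𝔻 T)) (sort-valid a T lkt)
  𝔻-Φ : ∀ T → 𝔻 (proj₁ (Φ T)) ≡ sort (𝔻 (proj₁ T))
  𝔻-Φ (T , lkt) = 𝔻-keyLabelling a (sort (𝔻 T)) (sort-valid a T lkt)
  injective : ∀ T T' → proj₁ (Φ T) ≡ proj₁ (Φ T') → proj₁ T ≡ proj₁ T'
  injective T T' e = lock-unique a (proj₁ T) (proj₁ T') (proj₂ T) (proj₂ T')
    (sort-injective _ _ (lock-allMatched a (proj₁ T) (proj₂ T)) (lock-allMatched a (proj₁ T') (proj₂ T'))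
      (trans (sym (𝔻-Φ T)) (trans (cong 𝔻 e) (𝔻-Φ T'))))
  weight : ∀ T → wt (𝔻 (proj₁ (Φ T))) ≡ wt (𝔻 (proj₁ T))
  weight T = trans (cong wt (𝔻-Φ T)) (tabulate-cong (λ r → rowCount-sort r (𝔻 (proj₁ T))))
  raising : ∀ i → 1 ≤ i → i < n → ∀ T T' → LockE a i (proj₁ T) (proj₁ T') → KeyE a i (proj₁ (Φ T)) (proj₁ (Φ T'))
  raising i 1≤i i<n T T' (_ , e) = proj₂ (Φ T') , (begin
    eD i (𝔻 (proj₁ (Φ T)))                ≡⟨ cong (eD i) (𝔻-Φ T) ⟩
    eD i (sort (𝔻 (proj₁ T)))             ≡⟨ eD-sort i (𝔻 (proj₁ T)) 1≤i i<n ⟩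
    Maybe.map sort (eD i (𝔻 (proj₁ T)))   ≡⟨ cong (Maybe.map sort) e ⟩
    just (sort (𝔻 (proj₁ T')))            ≡⟨ cong just (𝔻-Φ T') ⟨
    just (𝔻 (proj₁ (Φ T')))               ∎)
    where open ≡-Reasoning
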